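{- For every integer $n\ge1$, the vertex-face walk on the toroidal $(4,n)$-grid admits peak state transfer. Specifically, for all $(i,j)\in\mathbb{Z}_4\times\mathbb{Z}_n$: (a) if $n$ is odd, there is peak state transfer from vertex $(i,j)$ to the vertices $(i\pm1,j)$ at time $n$; (b) if $n=2m$ for some integer $m$, there is peak state transfer from vertex $(i,j)$ to the vertices $(i\pm1,j+m)$ at time $m$; (c) if $n=4k$ for some integer $k$, there is peak state transfer from vertex $(i,j)$ to the vertices $(i\pm1,j\pm k)$ (all choices of signs) at time $k$.
   Context: Toroidal $(n,m)$-grid ($n,m\ge1$): the embedding of $C_n\square C_m$ in the torus (a multigraph with doubled edges or loops if $n$ or $m$ is $2$ or $1$). Concretely: the vertex set is $V=\mathbb{Z}_n\times\mathbb{Z}_m$; with $e_1=(1,0)$, $e_2=(0,1)$, the set $\mathcal{A}$ of arcs consists of the $4nm$ pairs $(x,s)$ with $x\in V$ and $s\in\{+e_1,-e_1,+e_2,-e_2\}$ (four formally distinct directions, even if $n$ or $m$ is $1$ or $2$), the arc $(x,s)$ having tail $x$ and head $x+s$. The face set is $F=\mathbb{Z}_n\times\mathbb{Z}_m$, where the arcs lying inside face $f$ are the four arcs $(f,+e_1)$, $(f+e_1,+e_2)$, $(f+e_1+e_2,-e_1)$, $(f+e_2,-e_2)$ (the boundary walk of the unit square with corner $f$); each arc lies inside exactly one face. Vertex-face walk: $N\in\mathbb{R}^{\mathcal{A}\times V}$ has $N(a,x)=\frac12$ if $x$ is the tail of $a$ and $0$ otherwise; $M\in\mathbb{R}^{\mathcal{A}\times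 F}$ has $M(a,f)=\frac12$ if $a$ lies inside $f$ and $0$ otherwise. The transition matrix is $U=(2MM^T-I)(2NN^T-I)$. Put $B_t=N^TU^tN$ for integers $t\ge0$ and $B=B_1$, a symmetric matrix with spectral decomposition $B=\sum_\theta\theta E_\theta$ ($\theta$ over distinct eigenvalues, $E_\theta$ the orthogonal projection onto the $\theta$-eigenspace). For distinct vertices $x,y$ there is peak state transfer from $x$ to $y$ at time $t$ (a positive integer) if $|B_t(x,y)|=\sum_\theta|E_\theta(x,y)|$ and $E_\theta(x,y)\neq0$ for at least one $\theta$. -}

module Defs where

open import Level using (_⊔_) renaming (suc to lsuc)
open import Algebra.Bundles using (CommutativeRing)
open import Algebra.Apartness.Bundles using (HeytingCommutativeRing; HeytingField)
import Algebra.Definitions.RawMonoid as RawMonoidDefs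
open import Data.Bool.Base using (if_then_else_)
open import Data.Fin.Base using (Fin; zero; suc; toℕ; fromℕ<)
open import Data.Fin.Patterns using (0F; 1F; 2F; 3F)
open import Data.Fin.Properties using (inj⇒≟; *↔×)
open import Data.Integer.Base as ℤ using (ℤ; 0ℤ; 1ℤ; -1ℤ)
open import Data.Integer.DivMod using (_%ℕ_; n%ℕd<d)
open import Data.List.Base using (List; []; _∷_)
import Data.List.Membership.DecPropositional as DecMembership
open import Data.Nat.Base as ℕ using (ℕ; zero; suc; NonZero)
open import Data.Product.Base using (_×_; _,_; proj₁; proj₂; ∃-syntax)
open import Data.Product.Function.NonDependent.Propositional using (_×-↔_)
open import Data.Sum.Base using (_⊎_; inj₂)
open import Function.Base using (_∘_)
open import Function.Bundles using (_↔_; _⇔_; mk↔ₛ′; Inverse; Equivalence)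
open import Function.Construct.Composition using (_↔-∘_)
open import Function.Construct.Identity using (↔-id)
open import Function.Construct.Symmetry using (↔-sym)
open import Function.Properties.Inverse using (Inverse⇒Injection)
open import Relation.Binary.Core using (Rel)
open import Relation.Binary.Definitions using (DecidableEquality)
open import Relation.Binary.PropositionalEquality.Core using (_≡_; _≢_; refl)
open import Relation.Binary.Structures using (IsStrictPartialOrder)
open import Relation.Nullary.Decidable.Core using (⌊_⌋)
open import Relation.Nullary.Negation.Core using (¬_)

-- The real numbers, presented axiomatically as a Cauchy complete Archimedean
-- ordered field.  Classically ℝ is, up to isomorphism, the only model.  The
-- axioms are phrased with the apartness `#` (classically: ≠) and without
-- decidability, so that they also hold of the constructive reals.
record RealNumbers c ℓ₁ ℓ₂ : Set (lsuc (c ⊔ ℓ₁ ⊔ ℓ₂)) where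
  infix 4 _<_ _≤_
  field
    heytingField : HeytingField c ℓ₁ ℓ₂

  open HeytingField heytingField public
  open HeytingCommutativeRing heytingCommutativeRing public using (commutativeRing)

  field
    _<_                    : Rel Carrier ℓ₂
    <-isStrictPartialOrder : IsStrictPartialOrder _≈_ _<_
    #⇔<⊎>                  : ∀ x y → (x # y) ⇔ (x < y ⊎ y < x)
    0<1                    : 0# < 1#
    +-monoˡ-<              : ∀ {x y} z → x < y → x + z < y + z
    *-pos                  : ∀ {x y} → 0# < x → 0# < y → 0# < x * y

  _≤_ : Rel Carrier ℓ₂
  x ≤ y = ¬ (y < x)

  -- The absolute value is the least upper bound of x and - x; it is a field of
  -- the record because the order is not assumed decidable.
  field
    ∣_∣    : Carrier → Carrier
    ∣∣-lub : ∀ x z → (∣ x ∣ ≤ z) ⇔ (x ≤ z × - x ≤ z)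

  open RawMonoidDefs (CommutativeRing.+-rawMonoid commutativeRing) public
    using (sum) renaming (_×_ to _·_)

  Cauchy : (ℕ → Carrier) → Set _
  Cauchy f = ∀ ε → 0# < ε →
    ∃[ k ] (∀ p q → k ℕ.≤ p → k ℕ.≤ q → ∣ f p - f q ∣ < ε)

  _ConvergesTo_ : (ℕ → Carrier) → Carrier → Set _
  f ConvergesTo l = ∀ ε → 0# < ε → ∃[ k ] (∀ p → k ℕ.≤ p → ∣ f p - l ∣ < ε)

  field
    archimedean : ∀ x → ∃[ k ] (x < k · 1#)
    complete    : ∀ f → Cauchy f → ∃[ l ] (f ConvergesTo l)

  2# : Carrier
  2# = 1# + 1#

  0<2 : 0# < 2#
  0<2 = <-trans 0<1 (<-respˡ-≈ (+-identityˡ 1#) (+-monoˡ-< 1# 0<1))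
    where open IsStrictPartialOrder <-isStrictPartialOrder using (<-respˡ-≈) renaming (trans to <-trans)

  2#0 : 2# # 0#
  2#0 = Equivalence.from (#⇔<⊎> 2# 0#) (inj₂ 0<2)

  ½ : Carrier
  ½ = proj₁ (#⇒invertible 2#0)

  ½*2≈1 : ½ * 2# ≈ 1#
  ½*2≈1 = trans (*-congˡ (sym 2-0≈2)) (proj₁ (proj₂ (#⇒invertible 2#0)))
    where
    2-0≈2 : 2# - 0# ≈ 2#
    2-0≈2 = trans (+-congˡ (trans (sym (+-identityˡ _)) (-‿inverseʳ 0#))) (+-identityʳ 2#)

record Finite (A : Set) : Set where
  field
    size    : ℕ
    indexed : A ↔ Fin size

  infix 4 _≟_
  _≟_ : DecidableEquality A
  _≟_ = inj⇒≟ (Inverse⇒Injection indexed)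

open Finite {{...}} using (_≟_)

instance
  Fin-finite : ∀ {n} → Finite (Fin n)
  Fin-finite {n} = record { size = n ; indexed = ↔-id (Fin n) }

  ×-finite : ∀ {A B} → {{Finite A}} → {{Finite B}} → Finite (A × B)
  ×-finite {{FA}} {{FB}} = record
    { size    = Finite.size FA ℕ.* Finite.size FB
    ; indexed = ↔-sym *↔× ↔-∘ (Finite.indexed FA ×-↔ Finite.indexed FB)
    }

module LinearAlgebra {c ℓ₁ ℓ₂} (ℝ : RealNumbers c ℓ₁ ℓ₂) where

  open RealNumbers ℝ

  private variable
    A B C : Set

  ∑ : {{Finite A}} → (A → Carrier) → Carrier
  ∑ {{FA}} f = sum (f ∘ Inverse.from (Finite.indexed FA))

  Vector : Set → Set c
  Vector A = A → Carrier

  Matrix : Set → Set → Set c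
  Matrix A B = A → B → Carrier

  1ᴹ : {{Finite A}} → Matrix A A
  1ᴹ a b = if ⌊ a ≟ b ⌋ then 1# else 0#

  infixl 7 _*ᴹ_ _*ⱽ_
  infixl 8 _^ᴹ_
  infix  9 _ᵀ

  _*ᴹ_ : {{Finite B}} → Matrix A B → Matrix B C → Matrix A C
  (P *ᴹ Q) a c = ∑ λ b → P a b * Q b c

  _*ⱽ_ : {{Finite B}} → Matrix A B → Vector B → Vector A
  (P *ⱽ v) a = ∑ λ b → P a b * v b

  _ᵀ : Matrix A B → Matrix B A
  (P ᵀ) b a = P a b

  _^ᴹ_ : {{Finite A}} → Matrix A A → ℕ → Matrix A A
  P ^ᴹ zero  = 1ᴹ
  P ^ᴹ suc t = P *ᴹ P ^ᴹ t

  ⟨_,_⟩ : {{Finite A}} → Vector A → Vector A → Carrier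
  ⟨ v , w ⟩ = ∑ λ a → v a * w a

  Eigenspace : {{Finite A}} → Matrix A A → Carrier → Vector A → Set ℓ₁
  Eigenspace P μ v = ∀ a → (P *ⱽ v) a ≈ μ * v a

  IsEigenvalue : {{Finite A}} → Matrix A A → Carrier → Set (c ⊔ ℓ₁ ⊔ ℓ₂)
  IsEigenvalue P μ =
    ∃[ v ] (Eigenspace P μ v × (∃[ a ] (v a # 0#)))

  IsOrthogonalProjection : {{Finite A}} →
    Matrix A A → (Vector A → Set ℓ₁) → Set (c ⊔ ℓ₁)
  IsOrthogonalProjection P W = ∀ v →
    W (P *ⱽ v) × (∀ w → W w → ⟨ (λ a → v a - (P *ⱽ v) a) , w ⟩ ≈ 0#)

  -- θ lists the distinct eigenvalues of P, each exactly once, so the data are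
  -- determined by P up to the order of the list.
  record SpectralDecomposition {{_ : Finite A}} (P : Matrix A A)
    : Set (c ⊔ ℓ₁ ⊔ ℓ₂) where
    field
      count         : ℕ
      θ             : Fin count → Carrier
      E             : Fin count → Matrix A A
      θ-distinct    : ∀ {p q} → p ≢ q → θ p # θ q
      θ-eigenvalue  : ∀ p → IsEigenvalue P (θ p)
      θ-exhaustive  : ∀ μ → IsEigenvalue P μ → ∃[ p ] (μ ≈ θ p)
      E-projection  : ∀ p → IsOrthogonalProjection (E p) (Eigenspace P (θ p))
      decomposition : ∀ a b → P a b ≈ ∑ λ p → θ p * E p a b

data Direction : Set where
  +e₁ -e₁ +e₂ -e₂ : Direction

instance
  Direction-finite : Finite Direction
  Direction-finite = record { size = 4 ; indexed = mk↔ₛ′ to from to-from from-to }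
    where
    to : Direction → Fin 4
    to +e₁ = 0F
    to -e₁ = 1F
    to +e₂ = 2F
    to -e₂ = 3F
    from : Fin 4 → Direction
    from 0F = +e₁
    from 1F = -e₁
    from 2F = +e₂
    from 3F = -e₂
    to-from : ∀ i → to (from i) ≡ i
    to-from 0F = refl
    to-from 1F = refl
    to-from 2F = refl
    to-from 3F = refl
    from-to : ∀ s → from (to s) ≡ s
    from-to +e₁ = refl
    from-to -e₁ = refl
    from-to +e₂ = refl
    from-to -e₂ = refl

step : Direction → ℤ × ℤ
step +e₁ = 1ℤ , 0ℤ
step -e₁ = -1ℤ , 0ℤ
step +e₂ = 0ℤ , 1ℤ
step -e₂ = 0ℤ , -1ℤ

-- ℤₙ is represented by Fin n, and i ⊕ z is the residue of i + z modulo n.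
infixl 6 _⊕_
_⊕_ : ∀ {n} → .{{NonZero n}} → Fin n → ℤ → Fin n
_⊕_ {n} i z = fromℕ< (n%ℕd<d (ℤ.+ toℕ i ℤ.+ z) n)

module ToroidalGrid (n m : ℕ) .{{_ : NonZero n}} .{{_ : NonZero m}} where

  Vertex Face Arc : Set
  Vertex = Fin n × Fin m
  Face   = Fin n × Fin m
  Arc    = Vertex × Direction

  infixl 6 _⊞_
  _⊞_ : Vertex → ℤ × ℤ → Vertex
  (i , j) ⊞ (a , b) = i ⊕ a , j ⊕ b

  tail head : Arc → Vertex
  tail (x , _) = x
  head (x , s) = x ⊞ step s

  -- A face is identified with its corner vertex f.
  boundary : Face → List Arc
  boundary f =
      (f , +e₁)
    ∷ (f ⊞ step +e₁ , +e₂)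
    ∷ (f ⊞ step +e₁ ⊞ step +e₂ , -e₁)
    ∷ (f ⊞ step +e₂ , -e₂)
    ∷ []

module VertexFaceWalk {c ℓ₁ ℓ₂} (ℝ : RealNumbers c ℓ₁ ℓ₂)
  (n m : ℕ) .{{_ : NonZero n}} .{{_ : NonZero m}} where

  open RealNumbers ℝ
  open LinearAlgebra ℝ
  open ToroidalGrid n m public
  open DecMembership (_≟_ {A = Arc}) using (_∈?_)

  N : Matrix Arc Vertex
  N a x = if ⌊ x ≟ tail a ⌋ then ½ else 0#

  M : Matrix Arc Face
  M a f = if ⌊ a ∈? boundary f ⌋ then ½ else 0#

  U : Matrix Arc Arc
  U = (λ a b → 2# * (M *ᴹ M ᵀ) a b - 1ᴹ a b)
   *ᴹ (λ a b → 2# * (N *ᴹ N ᵀ) a b - 1ᴹ a b)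

  B : ℕ → Matrix Vertex Vertex
  B t = N ᵀ *ᴹ U ^ᴹ t *ᴹ N

  PeakStateTransfer : SpectralDecomposition (B 1) →
    Vertex → Vertex → ℕ → Set (ℓ₁ ⊔ ℓ₂)
  PeakStateTransfer D x y t =
      x ≢ y
    × 0 ℕ.< t
    × ∣ B t x y ∣ ≈ (∑ λ p → ∣ E p x y ∣)
    × (∃[ p ] (E p x y # 0#))
    where open SpectralDecomposition D

module Submission where

-- Let Bₜ = Nᵀ Uᵗ N and let Tₜ be the Chebyshev polynomials of the first kind.
-- Since N and M are isometries and U is a product of two reflections,
-- U² N = 2 U N B₁ - N, so that Bₜ₊₂ = 2 Bₜ₊₁ B₁ - Bₜ (B-recurrence) and
-- Bₜ = Tₜ(B₁) = ∑ Tₜ(θ) E_θ (functional-calculus, B-expand).  Hence there is peak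
-- state transfer from x to y at time t as soon as, with e = E_θ(x,y), every θ
-- satisfies Tₜ(θ)² e = e and Tₜ(θ) e ≥ 0, because then |e| = Tₜ(θ) e, and
-- some e is nonzero.
--
-- Counting pairs of arcs gives B₁ = Λ₁ Λ₂ / 8 - 1 with Λ = S + 2 + S⁻¹ in either
-- coordinate, S being the translation (B1▹-Λ).  So E_θ commutes with the
-- reflections of the torus (E▹-symmetry).  The reflection of ℤ₄ that fixes i
-- exchanges i + 1 and i - 1; therefore 4 E_θ((i,j),(i±1,b)) = φ(b) - γ(b), where
-- φ(b) and γ(b) are the contributions of the indicator of ℤ₄ × {b} and of the
-- same indicator with alternating signs along ℤ₄ (4*E).
--
--  * B₁ acts on the functions of the second coordinate as (S + S⁻¹) / 2, so
--    f(z) = φ(j + z) is an even solution of f(z+1) + f(z-1) = 2 θ f(z) with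
--    f(0) ≥ 0.  This replaces all trigonometry: it yields
--    f(z+t) + f(z-t) = 2 Tₜ(θ) f(z) (T-product), hence f(t) = Tₜ(θ) f(0) and
--    Tₜ(θ) f(t) = Tₜ(θ)² f(0) ≥ 0.  If n divides 4 t then f(3t) = f(-3t) = f(t),
--    and 4 Tₜ(θ)² f(t) = 3 f(t) + f(3t) = 4 f(t).
--  * B₁ acts on the alternating functions as -1, so γ(b) is 0 unless θ = -1, and
--    then it is the Kronecker symbol of j and b.
--
-- If n divides 4 t and either b = j ± t differs from j or Tₜ(-1) = -1, then
-- γ ≥ 0 and Tₜ(θ) γ = - γ, so 4 Tₜ(θ) e = Tₜ(θ) f(t) + γ ≥ 0 and Tₜ(θ)² e = e.
-- Some e is nonzero because 2 ∑ Tₜ(θ) f(t) = ∑ (f(2t) + f(0)) ≥ 1, the projections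
-- adding up to the identity (E▹-complete).  The three families of the theorem are
-- t = n with n odd, t = n / 2 and t = n / 4.
open import Defs

open import Algebra.Bundles using (CommutativeRing; RawRing)
import Algebra.Properties.CommutativeMonoid.Sum as CommutativeMonoidSum
import Algebra.Properties.Ring as RingProperties
import Algebra.Properties.Semiring.Mult.TCOptimised as NatMultiples
import Algebra.Properties.Semiring.Sum as SemiringSum
import Algebra.Solver.Ring as RingSolver
open import Algebra.Solver.Ring.AlmostCommutativeRing
  using (fromCommutativeRing; _-Raw-AlmostCommutative⟶_)
open import Data.Bool.Base using (if_then_else_)
open import Data.Fin.Base using (Fin; zero; suc; toℕ; fromℕ<)
open import Data.Fin.Patterns using (0F; 1F; 2F; 3F)
import Data.Fin.Properties as Finₚ
open import Data.Integer.Base as ℤ using (ℤ; 0ℤ; 1ℤ; -1ℤ; +_; -[1+_])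
open import Data.Integer.DivMod using (_/ℕ_; n%ℕd<d; a≡a%ℕn+[a/ℕn]*n)
import Data.Integer.Properties as ℤₚ
import Data.Integer.Solver as ℤSolver
import Data.List.Membership.DecPropositional as DecMembership
open import Data.List.Relation.Unary.Any using (here; there)
open import Data.Maybe.Base using (Maybe; just; nothing)
open import Data.Nat.Base as ℕ using (ℕ; zero; suc; NonZero)
open import Data.Nat.Divisibility as ℕ∣ using (_∣_; divides)
import Data.Nat.Properties as ℕₚ
open import Data.Product.Base using (_×_; _,_; proj₁; proj₂; ∃-syntax)
open import Data.Sum.Base using (_⊎_; inj₁; inj₂)
open import Function.Base using (_∘_)
open import Function.Bundles using (_↔_; mk↔ₛ′; Inverse; Equivalence)
open import Relation.Binary.PropositionalEquality.Core as ≡ using (_≡_; _≢_)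
import Relation.Binary.Reasoning.Setoid as SetoidReasoning
open import Relation.Binary.Structures using (IsStrictPartialOrder)
open import Relation.Nullary.Decidable.Core using (Dec; yes; no; ⌊_⌋)
open import Relation.Nullary.Negation.Core using (¬_; contradiction)

open Finite {{...}} using (_≟_)

-- The ring solver and ordered fields

-- The ring solver with integer coefficients, available in every commutative
-- ring because ℤ maps to it.
module IntegerSolver {c ℓ} (R : CommutativeRing c ℓ) where

  open CommutativeRing R using
    ( Carrier; _≈_; 0#; 1#; _-_; semiring; setoid; ring
    ; refl; sym; trans; reflexive; +-cong; +-congˡ; +-congʳ; +-assoc; +-comm
    ; +-identityˡ; +-identityʳ; -‿cong; -‿inverseʳ; *-congˡ; *-congʳ; zeroˡ )
    renaming (_+_ to _⊕ᴿ_; _*_ to _*ᴿ_; -_ to -ᴿ_)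
  open RingProperties ring using (-0#≈0#; -‿involutive; -‿+-comm; -‿distribˡ-*)
  open NatMultiples semiring using (×-homo-+; 1+×) renaming (_×_ to _×ᴿ_)
  open SetoidReasoning setoid

  -- The unique ring homomorphism from ℤ.
  ⟦_⟧ℤ : ℤ → Carrier
  ⟦ + n ⟧ℤ      = n ×ᴿ 1#
  ⟦ -[1+ n ] ⟧ℤ = -ᴿ (suc n ×ᴿ 1#)

  private
    ⊖-homo : ∀ m n → ⟦ m ℤ.⊖ n ⟧ℤ ≈ (m ×ᴿ 1#) - (n ×ᴿ 1#)
    ⊖-homo zero    zero    = sym (-‿inverseʳ 0#)
    ⊖-homo zero    (suc n) = sym (+-identityˡ _)
    ⊖-homo (suc m) zero    = sym (trans (+-congˡ -0#≈0#) (+-identityʳ _))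
    ⊖-homo (suc m) (suc n) = begin
      ⟦ suc m ℤ.⊖ suc n ⟧ℤ            ≡⟨ ≡.cong ⟦_⟧ℤ (ℤₚ.[1+m]⊖[1+n]≡m⊖n m n) ⟩
      ⟦ m ℤ.⊖ n ⟧ℤ                    ≈⟨ ⊖-homo m n ⟩
      a - b                           ≈⟨ +-identityˡ _ ⟨
      0# ⊕ᴿ (a - b)                   ≈⟨ +-congʳ (-‿inverseʳ 1#) ⟨
      (1# - 1#) ⊕ᴿ (a - b)            ≈⟨ +-assoc _ _ _ ⟩
      1# ⊕ᴿ (-ᴿ 1# ⊕ᴿ (a - b))        ≈⟨ +-congˡ (+-assoc _ _ _) ⟨
      1# ⊕ᴿ (-ᴿ 1# ⊕ᴿ a - b)          ≈⟨ +-congˡ (+-congʳ (+-comm _ _)) ⟩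
      1# ⊕ᴿ (a - 1# - b)              ≈⟨ +-congˡ (+-assoc _ _ _) ⟩
      1# ⊕ᴿ (a ⊕ᴿ (-ᴿ 1# - b))        ≈⟨ +-assoc _ _ _ ⟨
      (1# ⊕ᴿ a) ⊕ᴿ (-ᴿ 1# - b)        ≈⟨ +-congˡ (-‿+-comm 1# b) ⟩
      (1# ⊕ᴿ a) - (1# ⊕ᴿ b)           ≈⟨ +-cong (1+× m 1#) (-‿cong (1+× n 1#)) ⟨
      (suc m ×ᴿ 1#) - (suc n ×ᴿ 1#)     ∎
      where
      a b : Carrier
      a = m ×ᴿ 1#
      b = n ×ᴿ 1#

    -‿homo : ∀ z → ⟦ ℤ.- z ⟧ℤ ≈ -ᴿ ⟦ z ⟧ℤ
    -‿homo (+ zero)  = sym -0#≈0#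
    -‿homo (+ suc n) = refl
    -‿homo -[1+ n ]  = sym (-‿involutive _)

    +-homo : ∀ x y → ⟦ x ℤ.+ y ⟧ℤ ≈ ⟦ x ⟧ℤ ⊕ᴿ ⟦ y ⟧ℤ
    +-homo (+ m)    (+ n)    = ×-homo-+ 1# m n
    +-homo (+ m)    -[1+ n ] = ⊖-homo m (suc n)
    +-homo -[1+ m ] (+ n)    = trans (⊖-homo n (suc m)) (+-comm _ _)
    +-homo -[1+ m ] -[1+ n ] = begin
      -ᴿ (suc (suc (m ℕ.+ n)) ×ᴿ 1#)         ≡⟨ ≡.cong (λ k → -ᴿ (k ×ᴿ 1#)) (≡.cong suc (ℕₚ.+-suc m n)) ⟨
      -ᴿ ((suc m ℕ.+ suc n) ×ᴿ 1#)           ≈⟨ -‿cong (×-homo-+ 1# (suc m) (suc n)) ⟩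
      -ᴿ ((suc m ×ᴿ 1#) ⊕ᴿ (suc n ×ᴿ 1#))     ≈⟨ -‿+-comm _ _ ⟨
      -ᴿ (suc m ×ᴿ 1#) - (suc n ×ᴿ 1#)        ∎

    *-homo⁺ : ∀ m y → ⟦ + m ℤ.* y ⟧ℤ ≈ (m ×ᴿ 1#) *ᴿ ⟦ y ⟧ℤ
    *-homo⁺ zero    y = trans (reflexive (≡.cong ⟦_⟧ℤ (ℤₚ.*-zeroˡ y))) (sym (zeroˡ _))
    *-homo⁺ (suc m) y = begin
      ⟦ + suc m ℤ.* y ⟧ℤ               ≡⟨ ≡.cong ⟦_⟧ℤ (ℤₚ.suc-* (+ m) y) ⟩
      ⟦ y ℤ.+ + m ℤ.* y ⟧ℤ             ≈⟨ +-homo y (+ m ℤ.* y) ⟩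
      ⟦ y ⟧ℤ ⊕ᴿ ⟦ + m ℤ.* y ⟧ℤ         ≈⟨ +-cong (sym (*-identityˡ _)) (*-homo⁺ m y) ⟩
      1# *ᴿ ⟦ y ⟧ℤ ⊕ᴿ (m ×ᴿ 1#) *ᴿ ⟦ y ⟧ℤ ≈⟨ distribʳ _ _ _ ⟨
      (1# ⊕ᴿ (m ×ᴿ 1#)) *ᴿ ⟦ y ⟧ℤ       ≈⟨ *-congʳ (1+× m 1#) ⟨
      (suc m ×ᴿ 1#) *ᴿ ⟦ y ⟧ℤ           ∎
      where open CommutativeRing R using (*-identityˡ; distribʳ)

    *-homo : ∀ x y → ⟦ x ℤ.* y ⟧ℤ ≈ ⟦ x ⟧ℤ *ᴿ ⟦ y ⟧ℤ
    *-homo (+ m)    y = *-homo⁺ m y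
    *-homo -[1+ m ] y = begin
      ⟦ -[1+ m ] ℤ.* y ⟧ℤ            ≡⟨ ≡.cong ⟦_⟧ℤ (ℤₚ.neg-distribˡ-* (+ suc m) y) ⟨
      ⟦ ℤ.- (+ suc m ℤ.* y) ⟧ℤ       ≈⟨ -‿homo (+ suc m ℤ.* y) ⟩
      -ᴿ ⟦ + suc m ℤ.* y ⟧ℤ          ≈⟨ -‿cong (*-homo⁺ (suc m) y) ⟩
      -ᴿ ((suc m ×ᴿ 1#) *ᴿ ⟦ y ⟧ℤ)    ≈⟨ -‿distribˡ-* _ _ ⟩
      -ᴿ (suc m ×ᴿ 1#) *ᴿ ⟦ y ⟧ℤ      ∎

    ℤ-rawRing : RawRing _ _
    ℤ-rawRing = record
      { _≈_ = _≡_ ; _+_ = ℤ._+_ ; _*_ = ℤ._*_ ; -_ = ℤ.-_ ; 0# = 0ℤ ; 1# = 1ℤ }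

    morphism : ℤ-rawRing -Raw-AlmostCommutative⟶ fromCommutativeRing R
    morphism = record
      { ⟦_⟧ = ⟦_⟧ℤ ; +-homo = +-homo ; *-homo = *-homo ; -‿homo = -‿homo
      ; 0-homo = refl ; 1-homo = refl }

    _≟ℤ_ : ∀ x y → Maybe (⟦ x ⟧ℤ ≈ ⟦ y ⟧ℤ)
    x ≟ℤ y with x ℤₚ.≟ y
    ... | yes ≡.refl = just refl
    ... | no  _      = nothing

  open RingSolver ℤ-rawRing (fromCommutativeRing R) morphism _≟ℤ_ public
    using (solve; con; _:=_; _:+_; _:*_; _:-_; :-_)

-- Consequences of the axioms of an ordered field, without decidability.
module OrderedField {c ℓ₁ ℓ₂} (ℝ : RealNumbers c ℓ₁ ℓ₂) where

  open RealNumbers ℝ hiding (zero)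
  open IntegerSolver commutativeRing public
  open IsStrictPartialOrder <-isStrictPartialOrder public
    using (<-resp-≈; <-respˡ-≈; <-respʳ-≈) renaming (trans to <-trans; irrefl to <-irrefl)

  private variable
    x y z s w : Carrier

  <⇒# : x < y → x # y
  <⇒# x<y = Equivalence.from (#⇔<⊎> _ _) (inj₁ x<y)

  >⇒# : y < x → x # y
  >⇒# y<x = Equivalence.from (#⇔<⊎> _ _) (inj₂ y<x)

  #⇒<⊎> : x # y → x < y ⊎ y < x
  #⇒<⊎> = Equivalence.to (#⇔<⊎> _ _)

  -- The constructive substitute for the totality of the order.
  <-cotrans : x < y → ∀ z → x < z ⊎ z < y
  <-cotrans x<y z with #-cotrans (<⇒# x<y) z
  ... | inj₁ x#z with #⇒<⊎> x#z
  ...   | inj₁ x<z = inj₁ x<z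
  ...   | inj₂ z<x = inj₂ (<-trans z<x x<y)
  <-cotrans x<y z | inj₂ z#y with #⇒<⊎> z#y
  ...   | inj₁ z<y = inj₂ z<y
  ...   | inj₂ y<z = inj₁ (<-trans x<y y<z)

  ≤-<-trans : x ≤ y → y < z → x < z
  ≤-<-trans {x = x} x≤y y<z with <-cotrans y<z x
  ... | inj₁ y<x = contradiction y<x x≤y
  ... | inj₂ x<z = x<z

  <⇒≤ : x < y → x ≤ y
  <⇒≤ x<y y<x = <-irrefl refl (<-trans x<y y<x)

  ≈⇒≤ : x ≈ y → x ≤ y
  ≈⇒≤ x≈y y<x = <-irrefl (sym x≈y) y<x

  ≤-respʳ : y ≈ z → x ≤ y → x ≤ z
  ≤-respʳ y≈z x≤y z<x = x≤y (<-respˡ-≈ (sym y≈z) z<x)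

  #⇒≉ : x # y → ¬ x ≈ y
  #⇒≉ x#y x≈y = #-irrefl x≈y x#y

  <⇒0<- : x < y → 0# < y - x
  <⇒0<- {x} x<y = <-respˡ-≈ (-‿inverseʳ x) (+-monoˡ-< (- x) x<y)

  0≤+0< : 0# ≤ x → 0# < y → 0# < x + y
  0≤+0< {x} {y} 0≤x 0<y = ≤-<-trans 0≤x
    (<-respʳ-≈ (+-comm y x) (<-respˡ-≈ (+-identityˡ x) (+-monoˡ-< x 0<y)))

  0≤+ : 0# ≤ x → 0# ≤ y → 0# ≤ x + y
  0≤+ {x} {y} 0≤x 0≤y x+y<0 with <-cotrans x+y<0 y
  ... | inj₂ y<0 = 0≤y y<0
  ... | inj₁ x+y<y = 0≤x (<-respˡ-≈ (solve 2 (λ x y → x :+ y :- y := x) refl x y)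
                      (<-respʳ-≈ (-‿inverseʳ y) (+-monoˡ-< (- y) x+y<y)))

  #0∧0≤⇒0< : x # 0# → 0# ≤ x → 0# < x
  #0∧0≤⇒0< x#0 0≤x with #⇒<⊎> x#0
  ... | inj₁ x<0 = contradiction x<0 0≤x
  ... | inj₂ 0<x = 0<x

  x*y#0⇒y#0 : x * y # 0# → y # 0#
  x*y#0⇒y#0 {x} {y} xy#0 = invertible⇒# (xy⁻¹ * x , trans left eq , trans (*-comm _ _) (trans left eq))
    where
    xy⁻¹ : Carrier
    xy⁻¹ = proj₁ (#⇒invertible xy#0)
    eq : xy⁻¹ * (x * y - 0#) ≈ 1#
    eq = proj₁ (proj₂ (#⇒invertible xy#0))
    left : xy⁻¹ * x * (y - 0#) ≈ xy⁻¹ * (x * y - 0#)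
    left = solve 3 (λ x y z → z :* x :* (y :- con 0ℤ) := z :* (x :* y :- con 0ℤ)) refl x y xy⁻¹

  x*y#0⇒x#0 : x * y # 0# → x # 0#
  x*y#0⇒x#0 xy#0 with #⇒<⊎> xy#0
  ... | inj₁ xy<0 = x*y#0⇒y#0 (<⇒# (<-respˡ-≈ (*-comm _ _) xy<0))
  ... | inj₂ 0<xy = x*y#0⇒y#0 (>⇒# (<-respʳ-≈ (*-comm _ _) 0<xy))

  ¬#0⇒≈0 : ¬ (x # 0#) → x ≈ 0#
  ¬#0⇒≈0 = proj₁ (tight _ _)

  0≤* : 0# ≤ x → 0# ≤ y → 0# ≤ x * y
  0≤* 0≤x 0≤y xy<0 = <-irrefl refl (<-trans xy<0
    (*-pos (#0∧0≤⇒0< (x*y#0⇒x#0 (<⇒# xy<0)) 0≤x) (#0∧0≤⇒0< (x*y#0⇒y#0 (<⇒# xy<0)) 0≤y)))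

  <0⇒0<- : x < 0# → 0# < - x
  <0⇒0<- x<0 = <-respʳ-≈ (+-identityˡ _) (<⇒0<- x<0)

  #0⇒0<² : x # 0# → 0# < x * x
  #0⇒0<² {x} x#0 with #⇒<⊎> x#0
  ... | inj₂ 0<x = *-pos 0<x 0<x
  ... | inj₁ x<0 = <-respʳ-≈ (solve 1 (λ x → (:- x) :* (:- x) := x :* x) refl x)
                     (*-pos (<0⇒0<- x<0) (<0⇒0<- x<0))

  0≤² : ∀ x → 0# ≤ x * x
  0≤² x xx<0 = <-irrefl refl (<-trans xx<0 (#0⇒0<² (x*y#0⇒x#0 (<⇒# xx<0))))

  ²≈0⇒≈0 : x * x ≈ 0# → x ≈ 0#
  ²≈0⇒≈0 xx≈0 = ¬#0⇒≈0 λ x#0 → <-irrefl (sym xx≈0) (#0⇒0<² x#0)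

  private
    -- A nonnegative s with s² = w² is an upper bound of w.
    ²≈²⇒≤ : 0# ≤ s → s * s ≈ w * w → w ≤ s
    ²≈²⇒≤ {s} {w} 0≤s eq s<w = <-irrefl 0≈ (*-pos (<⇒0<- s<w) (0≤+0< 0≤s (≤-<-trans 0≤s s<w)))
      where
      0≈ : 0# ≈ (w - s) * (s + w)
      0≈ = trans (sym (-‿inverseʳ (w * w))) (trans (+-congˡ (-‿cong (sym eq)))
             (solve 2 (λ s w → w :* w :- s :* s := (w :- s) :* (s :+ w)) refl s w))

  -- A nonnegative square root of w² is the absolute value of w.
  ∣∣-unique : 0# ≤ s → s * s ≈ w * w → ∣ w ∣ ≈ s
  ∣∣-unique {s} {w} 0≤s eq = ¬#⇒≈ λ ∣w∣#s → case ∣w∣#s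
    where
    ¬#⇒≈ : ¬ (∣ w ∣ # s) → ∣ w ∣ ≈ s
    ¬#⇒≈ = proj₁ (tight _ _)
    neg² : s * s ≈ (- w) * (- w)
    neg² = trans eq (solve 1 (λ w → w :* w := (:- w) :* (:- w)) refl w)
    upper : ∣ w ∣ ≤ s
    upper = Equivalence.from (∣∣-lub w s) (²≈²⇒≤ 0≤s eq , ²≈²⇒≤ 0≤s neg²)
    bounds : w ≤ ∣ w ∣ × - w ≤ ∣ w ∣
    bounds = Equivalence.to (∣∣-lub w ∣ w ∣) (≈⇒≤ refl)
    case : ¬ (∣ w ∣ # s)
    case ∣w∣#s with #⇒<⊎> ∣w∣#s
    ... | inj₂ s<∣w∣ = upper s<∣w∣
    ... | inj₁ ∣w∣<s = <-irrefl 0≈ (*-pos (<⇒0<- (≤-<-trans (proj₁ bounds) ∣w∣<s))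
                                         (<⇒0<- (≤-<-trans (proj₂ bounds) ∣w∣<s)))
      where
      0≈ : 0# ≈ (s - w) * (s - (- w))
      0≈ = trans (sym (-‿inverseʳ (s * s))) (trans (+-congˡ (-‿cong eq))
             (solve 2 (λ s w → s :* s :- w :* w := (s :- w) :* (s :- (:- w))) refl s w))

  ½*[x+x]≈x : ∀ x → ½ * (x + x) ≈ x
  ½*[x+x]≈x x = trans (solve 2 (λ h x → h :* (x :+ x) := h :* con (+ 2) :* x) refl ½ x)
                 (trans (*-congʳ ½*2≈1) (*-identityˡ x))

  double-injective : x + x ≈ y + y → x ≈ y
  double-injective {x} {y} eq = trans (sym (½*[x+x]≈x x)) (trans (*-congˡ eq) (½*[x+x]≈x y))

-- Finite sums, matrices and vectors

module FiniteSums {c ℓ₁ ℓ₂} (ℝ : RealNumbers c ℓ₁ ℓ₂) where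

  open RealNumbers ℝ hiding (zero)
  open LinearAlgebra ℝ
  open OrderedField ℝ
  open CommutativeRing commutativeRing using (+-commutativeMonoid; semiring)
  private
    module Σ = CommutativeMonoidSum +-commutativeMonoid
    module Π = SemiringSum semiring
  open SetoidReasoning setoid

  private variable
    A B C : Set
    P : Set

  if-yes : {x y : Carrier} (d : Dec P) → P → (if ⌊ d ⌋ then x else y) ≈ x
  if-yes (yes _) p = refl
  if-yes (no ¬p) p = contradiction p ¬p

  if-no : {x y : Carrier} (d : Dec P) → ¬ P → (if ⌊ d ⌋ then x else y) ≈ y
  if-no (yes p) ¬p = contradiction p ¬p
  if-no (no _)  ¬p = refl

  private
    sum-zero : ∀ {n} (f : Fin n → Carrier) → (∀ i → f i ≈ 0#) → sum f ≈ 0#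
    sum-zero {n} f f≈0 = trans (Σ.sum-cong-≋ f≈0) (Σ.sum-replicate-zero n)

    sum-single : ∀ {n} (f : Fin n → Carrier) i → (∀ j → j ≢ i → f j ≈ 0#) → sum f ≈ f i
    sum-single f zero h = trans (+-congˡ (sum-zero (f ∘ suc) λ j → h (suc j) λ ())) (+-identityʳ _)
    sum-single f (suc i) h = trans (+-congʳ (h zero λ ())) (trans (+-identityˡ _)
      (sum-single (f ∘ suc) i λ j j≢i → h (suc j) λ { ≡.refl → j≢i ≡.refl }))

    sum-nonneg : ∀ {n} (f : Fin n → Carrier) → (∀ i → 0# ≤ f i) → 0# ≤ sum f
    sum-nonneg {zero}  f h = ≈⇒≤ refl
    sum-nonneg {suc n} f h = 0≤+ (h zero) (sum-nonneg (f ∘ suc) (h ∘ suc))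

    sum≈0⇒≈0 : ∀ {n} (f : Fin n → Carrier) → (∀ i → 0# ≤ f i) → sum f ≈ 0# → ∀ i → f i ≈ 0#
    sum≈0⇒≈0 {suc n} f h Σ≈0 zero = ¬#0⇒≈0 λ f₀#0 → <-irrefl (sym (trans (+-comm _ _) Σ≈0))
      (0≤+0< (sum-nonneg (f ∘ suc) (h ∘ suc)) (#0∧0≤⇒0< f₀#0 (h zero)))
    sum≈0⇒≈0 {suc n} f h Σ≈0 (suc i) = sum≈0⇒≈0 (f ∘ suc) (h ∘ suc) tail≈0 i
      where
      tail≈0 : sum (f ∘ suc) ≈ 0#
      tail≈0 = ¬#0⇒≈0 λ t#0 → <-irrefl (sym Σ≈0)
        (0≤+0< (h zero) (#0∧0≤⇒0< t#0 (sum-nonneg (f ∘ suc) (h ∘ suc))))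

    0<sum⇒∃0< : ∀ {n} (f : Fin n → Carrier) → 0# < sum f → ∃[ i ] 0# < f i
    0<sum⇒∃0< {zero}  f 0<0 = contradiction 0<0 (<-irrefl refl)
    0<sum⇒∃0< {suc n} f 0<Σ with <-cotrans 0<Σ (f zero)
    ... | inj₁ 0<f₀ = zero , 0<f₀
    ... | inj₂ f₀<Σ with 0<sum⇒∃0< (f ∘ suc) (<-respʳ-≈
                           (solve 2 (λ a b → a :+ b :- a := b) refl (f zero) (sum (f ∘ suc)))
                           (<⇒0<- f₀<Σ))
    ...   | i , 0<fᵢ = suc i , 0<fᵢ

  -- The sum of f over A, opaque so that the summand can be recovered from the
  -- sum by unification.
  opaque
    ⅀ : {{Finite A}} → (A → Carrier) → Carrier
    ⅀ f = ∑ f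

    ⅀≈∑ : {{_ : Finite A}} (f : A → Carrier) → ⅀ f ≈ ∑ f
    ⅀≈∑ f = refl

  -- The product of a matrix and a vector, by means of the opaque sum.
  infixl 7 _▹_
  _▹_ : {{Finite B}} → Matrix A B → Vector B → Vector A
  (P ▹ v) a = ⅀ λ b → P a b * v b

  -- The inner product, by means of the opaque sum.
  infix 6.5 _∙_
  _∙_ : {{Finite A}} → Vector A → Vector A → Carrier
  v ∙ w = ⅀ λ a → v a * w a

  module _ {{FA : Finite A}} where

    private
      module Index = Inverse (Finite.indexed FA)
      open Index using (to; from)

      from-to : ∀ a → from (to a) ≡ a
      from-to a = Index.strictlyInverseʳ a

      to-from : ∀ i → to (from i) ≡ i
      to-from i = Index.strictlyInverseˡ i

    opaque
      unfolding ⅀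

      ⅀-cong : {f g : A → Carrier} → (∀ a → f a ≈ g a) → ⅀ f ≈ ⅀ g
      ⅀-cong f≈g = Σ.sum-cong-≋ (λ i → f≈g (from i))

      ⅀-+ : (f g : A → Carrier) → ⅀ (λ a → f a + g a) ≈ ⅀ f + ⅀ g
      ⅀-+ f g = Σ.∑-distrib-+ (f ∘ from) (g ∘ from)

      ⅀-*ˡ : ∀ x (f : A → Carrier) → ⅀ (λ a → x * f a) ≈ x * ⅀ f
      ⅀-*ˡ x f = sym (Π.*-distribˡ-sum x (f ∘ from))

      ⅀-*ʳ : ∀ x (f : A → Carrier) → ⅀ (λ a → f a * x) ≈ ⅀ f * x
      ⅀-*ʳ x f = sym (Π.*-distribʳ-sum x (f ∘ from))

      ⅀-zero : {f : A → Carrier} → (∀ a → f a ≈ 0#) → ⅀ f ≈ 0#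
      ⅀-zero f≈0 = sum-zero _ (λ i → f≈0 (from i))

      -- A sum with at most one nonzero term.
      ⅀-single : (f : A → Carrier) (a : A) → (∀ b → b ≢ a → f b ≈ 0#) → ⅀ f ≈ f a
      ⅀-single f a h = trans
        (sum-single (f ∘ from) (to a) λ i i≢ → h (from i) λ eq → i≢ (≡.trans (≡.sym (to-from i)) (≡.cong to eq)))
        (reflexive (≡.cong f (from-to a)))

      ⅀-nonneg : {f : A → Carrier} → (∀ a → 0# ≤ f a) → 0# ≤ ⅀ f
      ⅀-nonneg h = sum-nonneg _ (λ i → h (from i))

      ⅀≈0⇒≈0 : (f : A → Carrier) → (∀ a → 0# ≤ f a) → ⅀ f ≈ 0# → ∀ a → f a ≈ 0#
      ⅀≈0⇒≈0 f h Σ≈0 a = trans (reflexive (≡.cong f (≡.sym (from-to a))))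
        (sum≈0⇒≈0 (f ∘ from) (λ i → h (from i)) Σ≈0 (to a))

      0<⅀⇒∃0< : (f : A → Carrier) → 0# < ⅀ f → ∃[ a ] 0# < f a
      0<⅀⇒∃0< f 0<Σ with 0<sum⇒∃0< (f ∘ from) 0<Σ
      ... | i , 0<fᵢ = from i , 0<fᵢ

      ⅀-involution : (π : A → A) → (∀ a → π (π a) ≡ a) → (f : A → Carrier) → ⅀ (λ a → f (π a)) ≈ ⅀ f
      ⅀-involution π inv f = sym (trans (Σ.sum-permute (f ∘ from) perm)
        (Σ.sum-cong-≋ λ i → reflexive (≡.cong f (from-to (π (from i))))))
        where
        π′ : Fin (Finite.size FA) → Fin (Finite.size FA)
        π′ i = to (π (from i))
        inv′ : ∀ i → π′ (π′ i) ≡ i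
        inv′ i = ≡.trans (≡.cong (λ a → to (π a)) (from-to _)) (≡.trans (≡.cong to (inv _)) (to-from i))
        perm : Fin (Finite.size FA) ↔ Fin (Finite.size FA)
        perm = mk↔ₛ′ π′ π′ inv′ inv′

    ⅀-minus : (f g : A → Carrier) → ⅀ (λ a → f a - g a) ≈ ⅀ f - ⅀ g
    ⅀-minus f g = begin
      ⅀ (λ a → f a - g a)            ≈⟨ ⅀-cong (λ a → solve 2 (λ x y → x :- y := x :+ con -1ℤ :* y) refl (f a) (g a)) ⟩
      ⅀ (λ a → f a + (- 1#) * g a)   ≈⟨ ⅀-+ f (λ a → (- 1#) * g a) ⟩
      ⅀ f + ⅀ (λ a → (- 1#) * g a)   ≈⟨ +-congˡ (⅀-*ˡ (- 1#) g) ⟩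
      ⅀ f + (- 1#) * ⅀ g             ≈⟨ solve 2 (λ x y → x :+ con -1ℤ :* y := x :- y) refl (⅀ f) (⅀ g) ⟩
      ⅀ f - ⅀ g                      ∎

    ⅀-select : (a : A) (f : A → Carrier) → ⅀ (λ b → (if ⌊ b ≟ a ⌋ then f b else 0#)) ≈ f a
    ⅀-select a f = trans (⅀-single _ a λ b b≢a → if-no (b ≟ a) b≢a) (if-yes (a ≟ a) ≡.refl)

  module _ {{FA : Finite A}} {{FB : Finite B}} where

    opaque
      unfolding ⅀

      ⅀-comm : (f : A → B → Carrier) → ⅀ (λ a → ⅀ (f a)) ≈ ⅀ (λ b → ⅀ (λ a → f a b))
      ⅀-comm f = Σ.∑-comm (λ i j → f (Inverse.from (Finite.indexed FA) i) (Inverse.from (Finite.indexed FB) j))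

  -- Both sides are the sum of f p over all p, a and b with p = (a , b), for
  -- every enumeration of the product.
  ⅀-product : (FP : Finite (A × B)) {{FA : Finite A}} {{FB : Finite B}} (f : A × B → Carrier) →
    ⅀ {{FP}} f ≈ ⅀ (λ a → ⅀ (λ b → f (a , b)))
  ⅀-product {A} {B} FP {{FA}} {{FB}} f = begin
      ⅀ₚ f                                          ≈⟨ ⅀-cong {{FP}} inner ⟨
      ⅀ₚ (λ p → ⅀ (λ a → ⅀ (λ b → D p a b)))        ≈⟨ ⅀-comm {{FP}} {{FA}} (λ p a → ⅀ (D p a)) ⟩
      ⅀ (λ a → ⅀ₚ (λ p → ⅀ (λ b → D p a b)))        ≈⟨ ⅀-cong (λ a → ⅀-comm {{FP}} {{FB}} (λ p b → D p a b)) ⟩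
      ⅀ (λ a → ⅀ (λ b → ⅀ₚ (λ p → D p a b)))        ≈⟨ ⅀-cong (λ a → ⅀-cong (λ b → ⅀-select {{FP}} (a , b) f)) ⟩
      ⅀ (λ a → ⅀ (λ b → f (a , b)))                 ∎
      where
      ⅀ₚ : (A × B → Carrier) → Carrier
      ⅀ₚ = ⅀ {{FP}}
      D : A × B → A → B → Carrier
      D p a b = if ⌊ Finite._≟_ FP p (a , b) ⌋ then f p else 0#
      inner : ∀ p → ⅀ (λ a → ⅀ (λ b → D p a b)) ≈ f p
      inner p@(a₀ , b₀) = begin
        ⅀ (λ a → ⅀ (λ b → D p a b))   ≈⟨ ⅀-single _ a₀ (λ a a≢ → ⅀-zero λ b → if-no (Finite._≟_ FP p (a , b)) λ eq → a≢ (≡.sym (≡.cong proj₁ eq))) ⟩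
        ⅀ (λ b → D p a₀ b)            ≈⟨ ⅀-single _ b₀ (λ b b≢ → if-no (Finite._≟_ FP p (a₀ , b)) λ eq → b≢ (≡.sym (≡.cong proj₂ eq))) ⟩
        D p a₀ b₀                     ≈⟨ if-yes (Finite._≟_ FP p p) ≡.refl ⟩
        f p                           ∎

  -- Pointwise equality of vectors.
  infix 4 _≈ⱽ_
  _≈ⱽ_ : (v w : Vector A) → Set _
  v ≈ⱽ w = ∀ a → v a ≈ w a

  -- The standard basis vector at b.
  δ : {{Finite A}} → A → Vector A
  δ b a = 1ᴹ a b

  module Action {A B : Set} {{FB : Finite B}} (Q : Matrix A B) where

    ▹-cong : {v w : Vector B} → v ≈ⱽ w → Q ▹ v ≈ⱽ Q ▹ w
    ▹-cong v≈w a = ⅀-cong λ b → *-congˡ (v≈w b)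

    ▹-+ : ∀ v w → Q ▹ (λ b → v b + w b) ≈ⱽ (λ a → (Q ▹ v) a + (Q ▹ w) a)
    ▹-+ v w a = trans (⅀-cong λ b → distribˡ _ _ _) (⅀-+ _ _)

    ▹-scale : ∀ x v → Q ▹ (λ b → x * v b) ≈ⱽ (λ a → x * (Q ▹ v) a)
    ▹-scale x v a = trans
      (⅀-cong λ b → solve 3 (λ q x v → q :* (x :* v) := x :* (q :* v)) refl (Q a b) x (v b))
      (⅀-*ˡ x _)

    ▹-minus : ∀ v w → Q ▹ (λ b → v b - w b) ≈ⱽ (λ a → (Q ▹ v) a - (Q ▹ w) a)
    ▹-minus v w a = trans
      (⅀-cong λ b → solve 3 (λ q v w → q :* (v :- w) := q :* v :- q :* w) refl (Q a b) (v b) (w b))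
      (⅀-minus _ _)

    ▹-⅀ : {{FC : Finite C}} (v : C → Vector B) →
      Q ▹ (λ b → ⅀ (λ k → v k b)) ≈ⱽ (λ a → ⅀ (λ k → (Q ▹ v k) a))
    ▹-⅀ v a = trans (⅀-cong λ b → sym (⅀-*ˡ (Q a b) (λ k → v k b))) (⅀-comm _)

    ▹-δ : ∀ b → Q ▹ δ b ≈ⱽ (λ a → Q a b)
    ▹-δ b a = trans
      (⅀-single _ b λ b′ b′≢b → trans (*-congˡ (if-no (b′ ≟ b) b′≢b)) (zeroʳ _))
      (trans (*-congˡ (if-yes (b ≟ b) ≡.refl)) (*-identityʳ _))

  open Action public

  *ᴹ-▹ : {{FB : Finite B}} {{FC : Finite C}} (P : Matrix A B) (Q : Matrix B C) (v : Vector C) →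
    (P *ᴹ Q) ▹ v ≈ⱽ P ▹ (Q ▹ v)
  *ᴹ-▹ P Q v a = begin
    ((P *ᴹ Q) ▹ v) a                             ≈⟨ ⅀-cong (λ c → *-congʳ (⅀≈∑ (λ b → P a b * Q b c))) ⟨
    ⅀ (λ c → ⅀ (λ b → P a b * Q b c) * v c)      ≈⟨ ⅀-cong (λ c → ⅀-*ʳ (v c) (λ b → P a b * Q b c)) ⟨
    ⅀ (λ c → ⅀ (λ b → P a b * Q b c * v c))      ≈⟨ ⅀-comm _ ⟩
    ⅀ (λ b → ⅀ (λ c → P a b * Q b c * v c))      ≈⟨ ⅀-cong (λ b → trans (⅀-cong (λ c → *-assoc _ _ _)) (⅀-*ˡ (P a b) (λ c → Q b c * v c))) ⟩
    ⅀ (λ b → P a b * ⅀ (λ c → Q b c * v c))      ∎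

  1ᴹ-▹ : {{FA : Finite A}} (v : Vector A) → 1ᴹ ▹ v ≈ⱽ v
  1ᴹ-▹ v a = trans
    (⅀-single _ a λ b b≢a → trans (*-congʳ (if-no (a ≟ b) (b≢a ∘ ≡.sym))) (zeroˡ _))
    (trans (*-congʳ (if-yes (a ≟ a) ≡.refl)) (*-identityˡ _))

  module InnerProduct {A : Set} {{FA : Finite A}} where

    ∙-cong : {v v′ w w′ : Vector A} → v ≈ⱽ v′ → w ≈ⱽ w′ → v ∙ w ≈ v′ ∙ w′
    ∙-cong v≈ w≈ = ⅀-cong λ a → *-cong (v≈ a) (w≈ a)

    ∙-comm : (v w : Vector A) → v ∙ w ≈ w ∙ v
    ∙-comm v w = ⅀-cong λ a → *-comm _ _

    ∙-minusˡ : (u v w : Vector A) → (λ a → u a - v a) ∙ w ≈ (u ∙ w) - (v ∙ w)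
    ∙-minusˡ u v w = trans
      (⅀-cong λ a → solve 3 (λ u v w → (u :- v) :* w := u :* w :- v :* w) refl (u a) (v a) (w a))
      (⅀-minus _ _)

    ∙-scaleˡ : ∀ x (v w : Vector A) → (λ a → x * v a) ∙ w ≈ x * (v ∙ w)
    ∙-scaleˡ x v w = trans (⅀-cong λ a → *-assoc _ _ _) (⅀-*ˡ x _)

    ∙-scaleʳ : ∀ x (v w : Vector A) → v ∙ (λ a → x * w a) ≈ x * (v ∙ w)
    ∙-scaleʳ x v w = trans (∙-comm _ _) (trans (∙-scaleˡ x w v) (*-congˡ (∙-comm w v)))

    ∙-definite : (v : Vector A) → v ∙ v ≈ 0# → ∀ a → v a ≈ 0#
    ∙-definite v eq a = ²≈0⇒≈0 (⅀≈0⇒≈0 _ (λ b → 0≤² (v b)) eq a)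

    0≤∙ : (v : Vector A) → 0# ≤ v ∙ v
    0≤∙ v = ⅀-nonneg λ a → 0≤² (v a)

  open InnerProduct public

  ᵀ-adjoint : {{FA : Finite A}} {{FB : Finite B}} (P : Matrix A B) (v : Vector B) (w : Vector A) →
    (P ▹ v) ∙ w ≈ v ∙ (P ᵀ ▹ w)
  ᵀ-adjoint P v w = begin
    ⅀ (λ a → ⅀ (λ b → P a b * v b) * w a)   ≈⟨ ⅀-cong (λ a → ⅀-*ʳ (w a) (λ b → P a b * v b)) ⟨
    ⅀ (λ a → ⅀ (λ b → P a b * v b * w a))   ≈⟨ ⅀-comm _ ⟩
    ⅀ (λ b → ⅀ (λ a → P a b * v b * w a))   ≈⟨ ⅀-cong (λ b → trans (⅀-cong (λ a → solve 3 (λ p v w → p :* v :* w := v :* (p :* w)) refl (P a b) (v b) (w a))) (⅀-*ˡ (v b) (λ a → P a b * w a))) ⟩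
    ⅀ (λ b → v b * ⅀ (λ a → P a b * w a))   ∎

  SelfAdjoint : {{Finite A}} → Matrix A A → Set _
  SelfAdjoint P = ∀ v w → (P ▹ v) ∙ w ≈ v ∙ (P ▹ w)

-- Chebyshev polynomials, spectral decompositions and products of two reflections

module Chebyshev {c ℓ₁ ℓ₂} (ℝ : RealNumbers c ℓ₁ ℓ₂) where

  open RealNumbers ℝ hiding (zero)
  open OrderedField ℝ
  open SetoidReasoning setoid

  -- The Chebyshev polynomials of the first kind.
  T : ℕ → Carrier → Carrier
  T zero          x = 1#
  T (suc zero)    x = x
  T (suc (suc t)) x = 2# * (x * T (suc t) x) - T t x

  T-cong : ∀ t {x y} → x ≈ y → T t x ≈ T t y
  T-cong zero          x≈y = refl
  T-cong (suc zero)    x≈y = x≈y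
  T-cong (suc (suc t)) x≈y =
    +-cong (*-congˡ (*-cong x≈y (T-cong (suc t) x≈y))) (-‿cong (T-cong t x≈y))

  T[-1]-suc : ∀ t → T (suc t) (- 1#) ≈ - T t (- 1#)
  T[-1]-suc zero    = refl
  T[-1]-suc (suc t) = begin
    2# * (- 1# * T (suc t) (- 1#)) - T t (- 1#)   ≈⟨ +-congʳ (*-congˡ (*-congˡ (T[-1]-suc t))) ⟩
    2# * (- 1# * - T t (- 1#)) - T t (- 1#)       ≈⟨ solve 1 (λ x → con (+ 2) :* ((:- con 1ℤ) :* (:- x)) :- x := :- (:- x)) refl (T t (- 1#)) ⟩
    - (- T t (- 1#))                              ≈⟨ -‿cong (T[-1]-suc t) ⟨
    - T (suc t) (- 1#)                            ∎

  T[-1]-odd : ∀ k → T (suc (k ℕ.+ k)) (- 1#) ≈ - 1#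
  T[-1]-odd k = trans (T[-1]-suc (k ℕ.+ k)) (-‿cong (even k))
    where
    even : ∀ k → T (k ℕ.+ k) (- 1#) ≈ 1#
    even zero    = refl
    even (suc k) = begin
      T (suc (k ℕ.+ suc k)) (- 1#)       ≡⟨ ≡.cong (λ l → T (suc l) (- 1#)) (ℕₚ.+-suc k k) ⟩
      T (suc (suc (k ℕ.+ k))) (- 1#)     ≈⟨ T[-1]-suc (suc (k ℕ.+ k)) ⟩
      - T (suc (k ℕ.+ k)) (- 1#)         ≈⟨ -‿cong (T[-1]-suc (k ℕ.+ k)) ⟩
      - (- T (k ℕ.+ k) (- 1#))           ≈⟨ solve 1 (λ x → :- (:- x) := x) refl _ ⟩
      T (k ℕ.+ k) (- 1#)                 ≈⟨ even k ⟩
      1#                                 ∎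

module Eigenprojections {c ℓ₁ ℓ₂} (ℝ : RealNumbers c ℓ₁ ℓ₂) {A : Set} {{FA : Finite A}}
  (P : LinearAlgebra.Matrix ℝ A A)
  (selfAdjoint : FiniteSums.SelfAdjoint ℝ P) where

  open RealNumbers ℝ hiding (zero)
  open LinearAlgebra ℝ
  open OrderedField ℝ
  open FiniteSums ℝ
  open Chebyshev ℝ
  open SetoidReasoning setoid

  -- v belongs to the θ-eigenspace of P; the zero vector is included.
  Eigen : Carrier → Vector A → Set _
  Eigen θ v = P ▹ v ≈ⱽ (λ a → θ * v a)

  Eigen⇒Eigenspace : ∀ {θ v} → Eigen θ v → Eigenspace P θ v
  Eigen⇒Eigenspace {v = v} h a = trans (sym (⅀≈∑ (λ b → P a b * v b))) (h a)

  private
    -- Distinct eigenspaces are orthogonal.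
    eigen-orthogonal : ∀ {θ μ v w} → θ # μ → Eigen θ v → Eigen μ w → v ∙ w ≈ 0#
    eigen-orthogonal {θ} {μ} {v} {w} θ#μ hv hw = begin
      v ∙ w                           ≈⟨ *-identityˡ _ ⟨
      1# * (v ∙ w)                    ≈⟨ *-congʳ (proj₁ (proj₂ (#⇒invertible θ#μ))) ⟨
      inv * (θ - μ) * (v ∙ w)         ≈⟨ solve 4 (λ i t m x → i :* (t :- m) :* x := i :* (t :* x :- m :* x)) refl inv θ μ (v ∙ w) ⟩
      inv * (θ * (v ∙ w) - μ * (v ∙ w)) ≈⟨ *-congˡ (+-cong eq (-‿cong refl)) ⟩
      inv * (μ * (v ∙ w) - μ * (v ∙ w)) ≈⟨ solve 2 (λ i x → i :* (x :- x) := con 0ℤ) refl inv (μ * (v ∙ w)) ⟩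
      0#                              ∎
      where
      inv : Carrier
      inv = proj₁ (#⇒invertible θ#μ)
      eq : θ * (v ∙ w) ≈ μ * (v ∙ w)
      eq = begin
        θ * (v ∙ w)               ≈⟨ ∙-scaleˡ θ v w ⟨
        (λ a → θ * v a) ∙ w       ≈⟨ ∙-cong hv (λ _ → refl) ⟨
        (P ▹ v) ∙ w               ≈⟨ selfAdjoint v w ⟩
        v ∙ (P ▹ w)               ≈⟨ ∙-cong (λ _ → refl) hw ⟩
        v ∙ (λ a → μ * w a)       ≈⟨ ∙-scaleʳ μ v w ⟩
        μ * (v ∙ w)               ∎

  module Projection {θ : Carrier} {E : Matrix A A}
    (projection : IsOrthogonalProjection E (Eigenspace P θ)) where

    E▹-eigen : ∀ v → Eigen θ (E ▹ v)
    E▹-eigen v a = begin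
      (P ▹ (E ▹ v)) a      ≈⟨ ▹-cong P (λ b → ⅀≈∑ (λ a′ → E b a′ * v a′)) a ⟩
      (P ▹ (E *ⱽ v)) a     ≈⟨ ⅀≈∑ (λ b → P a b * (E *ⱽ v) b) ⟩
      (P *ⱽ (E *ⱽ v)) a    ≈⟨ proj₁ (projection v) a ⟩
      θ * (E *ⱽ v) a       ≈⟨ *-congˡ (⅀≈∑ (λ b → E a b * v b)) ⟨
      θ * (E ▹ v) a        ∎

    residual-orthogonal : ∀ v w → Eigen θ w → (λ a → v a - (E ▹ v) a) ∙ w ≈ 0#
    residual-orthogonal v w hw = begin
      (λ a → v a - (E ▹ v) a) ∙ w         ≈⟨ ∙-cong (λ a → +-congˡ (-‿cong (⅀≈∑ (λ b → E a b * v b)))) (λ _ → refl) ⟩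
      (λ a → v a - (E *ⱽ v) a) ∙ w        ≈⟨ ⅀≈∑ (λ a → (v a - (E *ⱽ v) a) * w a) ⟩
      ⟨ (λ a → v a - (E *ⱽ v) a) , w ⟩    ≈⟨ proj₂ (projection v) w (Eigen⇒Eigenspace hw) ⟩
      0#                                  ∎

    -- The orthogonal projection of v is the only vector of the eigenspace whose
    -- inner products with the eigenspace are those of v.
    E▹-unique : ∀ {v w} → Eigen θ w → (∀ u → Eigen θ u → v ∙ u ≈ w ∙ u) → E ▹ v ≈ⱽ w
    E▹-unique {v} {w} hw orth a = begin
      (E ▹ v) a                   ≈⟨ solve 2 (λ x y → x := y :+ (x :- y)) refl ((E ▹ v) a) (w a) ⟩
      w a + d a                   ≈⟨ +-congˡ (∙-definite d d∙d≈0 a) ⟩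
      w a + 0#                    ≈⟨ +-identityʳ _ ⟩
      w a                         ∎
      where
      d : Vector A
      d b = (E ▹ v) b - w b
      d-eigen : Eigen θ d
      d-eigen b = begin
        (P ▹ d) b                            ≈⟨ ▹-minus P (E ▹ v) w b ⟩
        (P ▹ (E ▹ v)) b - (P ▹ w) b          ≈⟨ +-cong (E▹-eigen v b) (-‿cong (hw b)) ⟩
        θ * (E ▹ v) b - θ * w b              ≈⟨ solve 3 (λ t x y → t :* x :- t :* y := t :* (x :- y)) refl θ ((E ▹ v) b) (w b) ⟩
        θ * d b                              ∎
      d∙d≈0 : d ∙ d ≈ 0#
      d∙d≈0 = begin
        d ∙ d                                          ≈⟨ ∙-minusˡ (E ▹ v) w d ⟩
        (E ▹ v) ∙ d - w ∙ d                            ≈⟨ +-congˡ (-‿cong (orth d d-eigen)) ⟨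
        (E ▹ v) ∙ d - v ∙ d                            ≈⟨ solve 2 (λ x y → x :- y := :- (y :- x)) refl ((E ▹ v) ∙ d) (v ∙ d) ⟩
        - (v ∙ d - (E ▹ v) ∙ d)                        ≈⟨ -‿cong (∙-minusˡ v (E ▹ v) d) ⟨
        - ((λ b → v b - (E ▹ v) b) ∙ d)                ≈⟨ -‿cong (residual-orthogonal v d d-eigen) ⟩
        - 0#                                           ≈⟨ solve 0 (:- con 0ℤ := con 0ℤ) refl ⟩
        0#                                             ∎

    E▹-fixes : ∀ {v} → Eigen θ v → E ▹ v ≈ⱽ v
    E▹-fixes hv = E▹-unique hv λ _ _ → refl

    E▹-annihilates : ∀ {μ v} → μ # θ → Eigen μ v → E ▹ v ≈ⱽ (λ _ → 0#)
    E▹-annihilates μ#θ hv = E▹-unique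
      (λ a → trans (⅀-zero λ _ → zeroʳ _) (sym (zeroʳ _)))
      (λ u hu → trans (eigen-orthogonal μ#θ hv hu) (sym (⅀-zero λ _ → zeroˡ _)))

    E▹-residual : ∀ v u → Eigen θ u → v ∙ u ≈ (E ▹ v) ∙ u
    E▹-residual v u hu = begin
      v ∙ u                                               ≈⟨ solve 2 (λ x y → x := (x :- y) :+ y) refl (v ∙ u) ((E ▹ v) ∙ u) ⟩
      (v ∙ u - (E ▹ v) ∙ u) + (E ▹ v) ∙ u                 ≈⟨ +-congʳ (∙-minusˡ v (E ▹ v) u) ⟨
      (λ a → v a - (E ▹ v) a) ∙ u + (E ▹ v) ∙ u           ≈⟨ +-congʳ (residual-orthogonal v u hu) ⟩
      0# + (E ▹ v) ∙ u                                    ≈⟨ +-identityˡ _ ⟩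
      (E ▹ v) ∙ u                                         ∎

    E▹-P▹ : ∀ v → E ▹ (P ▹ v) ≈ⱽ (λ a → θ * (E ▹ v) a)
    E▹-P▹ v = E▹-unique
      (λ a → trans (▹-scale P θ (E ▹ v) a) (*-congˡ (E▹-eigen v a)))
      λ u hu → begin
        (P ▹ v) ∙ u                     ≈⟨ selfAdjoint v u ⟩
        v ∙ (P ▹ u)                     ≈⟨ ∙-cong (λ _ → refl) hu ⟩
        v ∙ (λ a → θ * u a)             ≈⟨ ∙-scaleʳ θ v u ⟩
        θ * (v ∙ u)                     ≈⟨ *-congˡ (E▹-residual v u hu) ⟩
        θ * ((E ▹ v) ∙ u)               ≈⟨ ∙-scaleˡ θ (E ▹ v) u ⟨
        (λ a → θ * (E ▹ v) a) ∙ u       ∎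

    -- Every involutive symmetry of P is a symmetry of E.
    E▹-symmetry : (π : A → A) → (∀ a → π (π a) ≡ a) → (∀ v → P ▹ (v ∘ π) ≈ⱽ (P ▹ v) ∘ π) →
      ∀ v → E ▹ (v ∘ π) ≈ⱽ (E ▹ v) ∘ π
    E▹-symmetry π inv comm v = E▹-unique
      (λ a → trans (comm (E ▹ v) a) (E▹-eigen v (π a)))
      λ u hu → begin
        (v ∘ π) ∙ u                ≈⟨ transfer v u ⟩
        v ∙ (u ∘ π)                ≈⟨ E▹-residual v (u ∘ π) (λ a → trans (comm u a) (hu (π a))) ⟩
        (E ▹ v) ∙ (u ∘ π)          ≈⟨ transfer (E ▹ v) u ⟨
        ((E ▹ v) ∘ π) ∙ u          ∎
      where
      transfer : ∀ v u → (v ∘ π) ∙ u ≈ v ∙ (u ∘ π)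
      transfer v u = begin
        ⅀ (λ a → v (π a) * u a)             ≈⟨ ⅀-cong (λ a → *-congˡ (reflexive (≡.cong u (inv a)))) ⟨
        ⅀ (λ a → v (π a) * u (π (π a)))     ≈⟨ ⅀-involution π inv (λ a → v a * u (π a)) ⟩
        ⅀ (λ a → v a * u (π a))             ∎

  module Decomposition (D : SpectralDecomposition P) where

    open SpectralDecomposition D
    module Pr p = Projection {θ p} {E p} (E-projection p)

    private
      P▹-expand : ∀ v a → (P ▹ v) a ≈ ⅀ (λ p → θ p * (E p ▹ v) a)
      P▹-expand v a = begin
        ⅀ (λ b → P a b * v b)                              ≈⟨ ⅀-cong (λ b → *-congʳ (trans (decomposition a b) (sym (⅀≈∑ (λ p → θ p * E p a b))))) ⟩
        ⅀ (λ b → ⅀ (λ p → θ p * E p a b) * v b)            ≈⟨ ⅀-cong (λ b → ⅀-*ʳ (v b) (λ p → θ p * E p a b)) ⟨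
        ⅀ (λ b → ⅀ (λ p → θ p * E p a b * v b))            ≈⟨ ⅀-comm (λ b p → θ p * E p a b * v b) ⟩
        ⅀ (λ p → ⅀ (λ b → θ p * E p a b * v b))            ≈⟨ ⅀-cong (λ p → trans (⅀-cong (λ b → *-assoc (θ p) (E p a b) (v b))) (⅀-*ˡ (θ p) (λ b → E p a b * v b))) ⟩
        ⅀ (λ p → θ p * (E p ▹ v) a)                        ∎

      E▹E▹-distinct : ∀ {p q} → q ≢ p → ∀ v a → (E p ▹ (E q ▹ v)) a ≈ 0#
      E▹E▹-distinct q≢p v = Pr.E▹-annihilates _ (θ-distinct q≢p) (Pr.E▹-eigen _ v)

    -- The projections add up to the identity.  The remainder r = v - ∑ E p v lies
    -- in the kernel of P.  Were it nonzero, 0 would be some eigenvalue θ p, whose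
    -- projection fixes r; but every projection annihilates r.
    E▹-complete : ∀ v a → ⅀ (λ p → (E p ▹ v) a) ≈ v a
    E▹-complete v a = begin
      ⅀ (λ p → (E p ▹ v) a)         ≈⟨ solve 2 (λ s x → s := x :- (x :- s)) refl _ (v a) ⟩
      v a - r a                     ≈⟨ +-congˡ (-‿cong (¬#0⇒≈0 λ ra#0 → r≉0 ra#0 (θ-exhaustive 0# (r , Eigen⇒Eigenspace r-eigen , a , ra#0)))) ⟩
      v a - 0#                      ≈⟨ solve 1 (λ x → x :- con 0ℤ := x) refl (v a) ⟩
      v a                           ∎
      where
      S : Vector A
      S b = ⅀ (λ p → (E p ▹ v) b)
      r : Vector A
      r b = v b - S b
      r-eigen : Eigen 0# r
      r-eigen b = begin
        (P ▹ r) b                                   ≈⟨ ▹-minus P v S b ⟩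
        (P ▹ v) b - (P ▹ S) b                       ≈⟨ +-cong (P▹-expand v b) (-‿cong (trans (▹-⅀ P (λ p → E p ▹ v) b) (⅀-cong λ p → Pr.E▹-eigen p v b))) ⟩
        ⅀ (λ p → θ p * (E p ▹ v) b) - ⅀ (λ p → θ p * (E p ▹ v) b) ≈⟨ solve 2 (λ x y → x :- x := con 0ℤ :* y) refl _ (r b) ⟩
        0# * r b                                    ∎
      E▹r≈0 : ∀ p b → (E p ▹ r) b ≈ 0#
      E▹r≈0 p b = begin
        (E p ▹ r) b                                     ≈⟨ ▹-minus (E p) v S b ⟩
        (E p ▹ v) b - (E p ▹ S) b                       ≈⟨ +-congˡ (-‿cong (▹-⅀ (E p) (λ q → E q ▹ v) b)) ⟩
        (E p ▹ v) b - ⅀ (λ q → (E p ▹ (E q ▹ v)) b)     ≈⟨ +-congˡ (-‿cong (⅀-single _ p λ q q≢p → E▹E▹-distinct q≢p v b)) ⟩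
        (E p ▹ v) b - (E p ▹ (E p ▹ v)) b               ≈⟨ +-congˡ (-‿cong (Pr.E▹-fixes p (Pr.E▹-eigen p v) b)) ⟩
        (E p ▹ v) b - (E p ▹ v) b                       ≈⟨ -‿inverseʳ _ ⟩
        0#                                              ∎
      r≉0 : r a # 0# → ¬ (∃[ p ] 0# ≈ θ p)
      r≉0 ra#0 (p , 0≈θ) = #⇒≉ ra#0 (trans (sym (Pr.E▹-fixes p (λ b → trans (r-eigen b) (*-congʳ 0≈θ)) a)) (E▹r≈0 p a))

    -- A sequence of operators that starts with 1 and P and satisfies the
    -- Chebyshev recurrence is T t (P) = ∑ T t (θ p) E p.
    functional-calculus : (X : ℕ → Vector A → Vector A) →
      (∀ v → X 0 v ≈ⱽ v) → (∀ v → X 1 v ≈ⱽ P ▹ v) →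
      (∀ t v a → X (suc (suc t)) v a ≈ 2# * X (suc t) (P ▹ v) a - X t v a) →
      ∀ t v a → X t v a ≈ ⅀ (λ p → T t (θ p) * (E p ▹ v) a)
    functional-calculus X X0 X1 X2 zero v a =
      trans (X0 v a) (trans (sym (E▹-complete v a)) (⅀-cong λ p → sym (*-identityˡ _)))
    functional-calculus X X0 X1 X2 (suc zero) v a = trans (X1 v a) (P▹-expand v a)
    functional-calculus X X0 X1 X2 (suc (suc t)) v a = begin
      X (suc (suc t)) v a                              ≈⟨ X2 t v a ⟩
      2# * X (suc t) (P ▹ v) a - X t v a               ≈⟨ +-cong (*-congˡ (IH (suc t) (P ▹ v) a)) (-‿cong (IH t v a)) ⟩
      2# * ⅀ (λ p → T (suc t) (θ p) * (E p ▹ (P ▹ v)) a) - ⅀ (λ p → T t (θ p) * (E p ▹ v) a)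
        ≈⟨ +-congʳ (⅀-*ˡ 2# (λ p → T (suc t) (θ p) * (E p ▹ (P ▹ v)) a)) ⟨
      ⅀ (λ p → 2# * (T (suc t) (θ p) * (E p ▹ (P ▹ v)) a)) - ⅀ (λ p → T t (θ p) * (E p ▹ v) a)
        ≈⟨ ⅀-minus _ _ ⟨
      ⅀ (λ p → 2# * (T (suc t) (θ p) * (E p ▹ (P ▹ v)) a) - T t (θ p) * (E p ▹ v) a)
        ≈⟨ ⅀-cong (λ p → trans (+-congʳ (*-congˡ (*-congˡ (Pr.E▹-P▹ p v a))))
             (solve 4 (λ θ x y e → con (+ 2) :* (x :* (θ :* e)) :- y :* e := (con (+ 2) :* (θ :* x) :- y) :* e) refl (θ p) (T (suc t) (θ p)) (T t (θ p)) ((E p ▹ v) a))) ⟩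
      ⅀ (λ p → T (suc (suc t)) (θ p) * (E p ▹ v) a)    ∎
      where IH = functional-calculus X X0 X1 X2

-- The walk whose step is the product of the reflections about the ranges of
-- two isometries N and M.  That they are isometries is assumed only where it is
-- needed.
module TwoReflections {c ℓ₁ ℓ₂} (ℝ : RealNumbers c ℓ₁ ℓ₂) {A V F : Set}
  {{FA : Finite A}} {{FV : Finite V}} {{FF : Finite F}}
  (N : LinearAlgebra.Matrix ℝ A V) (M : LinearAlgebra.Matrix ℝ A F)
  where

  open RealNumbers ℝ hiding (zero)
  open LinearAlgebra ℝ
  open OrderedField ℝ
  open FiniteSums ℝ
  open Chebyshev ℝ using (T)
  open SetoidReasoning setoid

  -- The reflection 2 Q Qᵀ - 1, which fixes the range of Q if Q is an isometry.
  reflection : {B : Set} {{_ : Finite B}} → Matrix A B → Matrix A A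
  reflection Q a b = 2# * (Q *ᴹ Q ᵀ) a b - 1ᴹ a b

  U : Matrix A A
  U = reflection M *ᴹ reflection N

  B : ℕ → Matrix V V
  B t = N ᵀ *ᴹ U ^ᴹ t *ᴹ N

  module _ (N-isometry : ∀ u → N ᵀ ▹ (N ▹ u) ≈ⱽ u) where

    private
      reflection-▹ : {B : Set} {{_ : Finite B}} (Q : Matrix A B) → ∀ v a →
        (reflection Q ▹ v) a ≈ 2# * (Q ▹ (Q ᵀ ▹ v)) a - v a
      reflection-▹ Q v a = begin
        ⅀ (λ b → (2# * (Q *ᴹ Q ᵀ) a b - 1ᴹ a b) * v b)
          ≈⟨ ⅀-cong (λ b → solve 3 (λ q d v → (con (+ 2) :* q :- d) :* v := con (+ 2) :* (q :* v) :- d :* v) refl ((Q *ᴹ Q ᵀ) a b) (1ᴹ a b) (v b)) ⟩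
        ⅀ (λ b → 2# * ((Q *ᴹ Q ᵀ) a b * v b) - 1ᴹ a b * v b)       ≈⟨ ⅀-minus _ _ ⟩
        ⅀ (λ b → 2# * ((Q *ᴹ Q ᵀ) a b * v b)) - (1ᴹ ▹ v) a         ≈⟨ +-cong (⅀-*ˡ 2# (λ b → (Q *ᴹ Q ᵀ) a b * v b)) (-‿cong (1ᴹ-▹ v a)) ⟩
        2# * ((Q *ᴹ Q ᵀ) ▹ v) a - v a                              ≈⟨ +-congʳ (*-congˡ (*ᴹ-▹ Q (Q ᵀ) v a)) ⟩
        2# * (Q ▹ (Q ᵀ ▹ v)) a - v a                               ∎

      U▹N▹ : ∀ u → U ▹ (N ▹ u) ≈ⱽ (λ a → 2# * (M ▹ (M ᵀ ▹ (N ▹ u))) a - (N ▹ u) a)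
      U▹N▹ u a = begin
        (U ▹ (N ▹ u)) a                            ≈⟨ *ᴹ-▹ (reflection M) (reflection N) (N ▹ u) a ⟩
        (reflection M ▹ (reflection N ▹ (N ▹ u))) a ≈⟨ ▹-cong (reflection M) fixed a ⟩
        (reflection M ▹ (N ▹ u)) a                 ≈⟨ reflection-▹ M (N ▹ u) a ⟩
        2# * (M ▹ (M ᵀ ▹ (N ▹ u))) a - (N ▹ u) a   ∎
        where
        fixed : reflection N ▹ (N ▹ u) ≈ⱽ N ▹ u
        fixed b = begin
          (reflection N ▹ (N ▹ u)) b                  ≈⟨ reflection-▹ N (N ▹ u) b ⟩
          2# * (N ▹ (N ᵀ ▹ (N ▹ u))) b - (N ▹ u) b    ≈⟨ +-congʳ (*-congˡ (▹-cong N (N-isometry u) b)) ⟩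
          2# * (N ▹ u) b - (N ▹ u) b                  ≈⟨ solve 1 (λ x → con (+ 2) :* x :- x := x) refl ((N ▹ u) b) ⟩
          (N ▹ u) b                                   ∎

      B▹ : ∀ t u → B t ▹ u ≈ⱽ N ᵀ ▹ (U ^ᴹ t ▹ (N ▹ u))
      B▹ t u x = trans (*ᴹ-▹ (N ᵀ *ᴹ U ^ᴹ t) N u x) (*ᴹ-▹ (N ᵀ) (U ^ᴹ t) (N ▹ u) x)

      ^ᴹ-suc : ∀ t v → U ^ᴹ suc t ▹ v ≈ⱽ U ^ᴹ t ▹ (U ▹ v)
      ^ᴹ-suc zero v a = begin
        (U *ᴹ 1ᴹ ▹ v) a         ≈⟨ *ᴹ-▹ U 1ᴹ v a ⟩
        (U ▹ (1ᴹ ▹ v)) a        ≈⟨ ▹-cong U (1ᴹ-▹ v) a ⟩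
        (U ▹ v) a               ≈⟨ 1ᴹ-▹ (U ▹ v) a ⟨
        (1ᴹ ▹ (U ▹ v)) a        ∎
      ^ᴹ-suc (suc t) v a = begin
        (U ^ᴹ suc (suc t) ▹ v) a          ≈⟨ *ᴹ-▹ U (U ^ᴹ suc t) v a ⟩
        (U ▹ (U ^ᴹ suc t ▹ v)) a          ≈⟨ ▹-cong U (^ᴹ-suc t v) a ⟩
        (U ▹ (U ^ᴹ t ▹ (U ▹ v))) a        ≈⟨ *ᴹ-▹ U (U ^ᴹ t) (U ▹ v) a ⟨
        (U ^ᴹ suc t ▹ (U ▹ v)) a          ∎

    B0▹ : ∀ u → B 0 ▹ u ≈ⱽ u
    B0▹ u x = begin
      (B 0 ▹ u) x                     ≈⟨ B▹ 0 u x ⟩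
      (N ᵀ ▹ (1ᴹ ▹ (N ▹ u))) x        ≈⟨ ▹-cong (N ᵀ) (1ᴹ-▹ (N ▹ u)) x ⟩
      (N ᵀ ▹ (N ▹ u)) x               ≈⟨ N-isometry u x ⟩
      u x                             ∎

    -- B₁ = 2 Nᵀ M Mᵀ N - 1, since the reflection about the range of N fixes N u.
    B1▹ : ∀ u → B 1 ▹ u ≈ⱽ (λ x → 2# * (N ᵀ ▹ (M ▹ (M ᵀ ▹ (N ▹ u)))) x - u x)
    B1▹ u x = begin
      (B 1 ▹ u) x                                             ≈⟨ B▹ 1 u x ⟩
      (N ᵀ ▹ (U ^ᴹ 1 ▹ (N ▹ u))) x                            ≈⟨ ▹-cong (N ᵀ) (λ a → trans (^ᴹ-suc 0 (N ▹ u) a) (1ᴹ-▹ (U ▹ (N ▹ u)) a)) x ⟩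
      (N ᵀ ▹ (U ▹ (N ▹ u))) x                                 ≈⟨ ▹-cong (N ᵀ) (U▹N▹ u) x ⟩
      (N ᵀ ▹ (λ a → 2# * MMN a - (N ▹ u) a)) x                ≈⟨ ▹-minus (N ᵀ) (λ a → 2# * MMN a) (N ▹ u) x ⟩
      (N ᵀ ▹ (λ a → 2# * MMN a)) x - (N ᵀ ▹ (N ▹ u)) x        ≈⟨ +-cong (▹-scale (N ᵀ) 2# MMN x) (-‿cong (N-isometry u x)) ⟩
      2# * (N ᵀ ▹ MMN) x - u x                                ∎
      where
      MMN : Vector A
      MMN = M ▹ (M ᵀ ▹ (N ▹ u))

    B1-selfAdjoint : SelfAdjoint (B 1)
    B1-selfAdjoint v w = begin
      (B 1 ▹ v) ∙ w                               ≈⟨ half v w ⟩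
      2# * (K v ∙ K w) - v ∙ w                    ≈⟨ +-cong (*-congˡ (∙-comm (K v) (K w))) (-‿cong (∙-comm v w)) ⟩
      2# * (K w ∙ K v) - w ∙ v                    ≈⟨ half w v ⟨
      (B 1 ▹ w) ∙ v                               ≈⟨ ∙-comm (B 1 ▹ w) v ⟩
      v ∙ (B 1 ▹ w)                               ∎
      where
      K : Vector V → Vector F
      K u = M ᵀ ▹ (N ▹ u)
      half : ∀ v w → (B 1 ▹ v) ∙ w ≈ 2# * (K v ∙ K w) - v ∙ w
      half v w = begin
        (B 1 ▹ v) ∙ w                                         ≈⟨ ∙-cong (B1▹ v) (λ _ → refl) ⟩
        (λ x → 2# * (N ᵀ ▹ (M ▹ K v)) x - v x) ∙ w            ≈⟨ ∙-minusˡ (λ x → 2# * (N ᵀ ▹ (M ▹ K v)) x) v w ⟩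
        (λ x → 2# * (N ᵀ ▹ (M ▹ K v)) x) ∙ w - v ∙ w          ≈⟨ +-congʳ (∙-scaleˡ 2# (N ᵀ ▹ (M ▹ K v)) w) ⟩
        2# * ((N ᵀ ▹ (M ▹ K v)) ∙ w) - v ∙ w                  ≈⟨ +-congʳ (*-congˡ (ᵀ-adjoint (N ᵀ) (M ▹ K v) w)) ⟩
        2# * ((M ▹ K v) ∙ (N ▹ w)) - v ∙ w                    ≈⟨ +-congʳ (*-congˡ (ᵀ-adjoint M (K v) (N ▹ w))) ⟩
        2# * (K v ∙ K w) - v ∙ w                              ∎

    module _ (M-isometry : ∀ u → M ᵀ ▹ (M ▹ u) ≈ⱽ u) where

      private
        -- U² N = 2 U N B₁ - N.
        U▹U▹N▹ : ∀ u → U ▹ (U ▹ (N ▹ u)) ≈ⱽ (λ a → 2# * (U ▹ (N ▹ (B 1 ▹ u))) a - (N ▹ u) a)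
        U▹U▹N▹ u a = begin
          (U ▹ (U ▹ (N ▹ u))) a                    ≈⟨ *ᴹ-▹ (reflection M) (reflection N) (U ▹ (N ▹ u)) a ⟩
          (RM ▹ (reflection N ▹ (U ▹ (N ▹ u)))) a  ≈⟨ ▹-cong RM inner a ⟩
          (RM ▹ (λ b → 2# * N▹B b - (U ▹ (N ▹ u)) b)) a ≈⟨ ▹-minus RM (λ b → 2# * N▹B b) (U ▹ (N ▹ u)) a ⟩
          (RM ▹ (λ b → 2# * N▹B b)) a - (RM ▹ (U ▹ (N ▹ u))) a ≈⟨ +-cong (▹-scale RM 2# N▹B a) (-‿cong (RM-involutive a)) ⟩
          2# * (RM ▹ N▹B) a - (N ▹ u) a            ≈⟨ +-congʳ (*-congˡ (trans (reflection-▹ M N▹B a) (sym (U▹N▹ (B 1 ▹ u) a)))) ⟩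
          2# * (U ▹ N▹B) a - (N ▹ u) a             ∎
          where
          RM : Matrix A A
          RM = reflection M
          N▹B : Vector A
          N▹B = N ▹ (B 1 ▹ u)
          inner : reflection N ▹ (U ▹ (N ▹ u)) ≈ⱽ (λ b → 2# * N▹B b - (U ▹ (N ▹ u)) b)
          inner b = trans (reflection-▹ N (U ▹ (N ▹ u)) b)
            (+-congʳ (*-congˡ (▹-cong N (λ x → sym (trans (B▹ 1 u x) (▹-cong (N ᵀ) (λ c → trans (^ᴹ-suc 0 (N ▹ u) c) (1ᴹ-▹ (U ▹ (N ▹ u)) c)) x))) b)))
          RM-involutive : RM ▹ (U ▹ (N ▹ u)) ≈ⱽ N ▹ u
          RM-involutive b = begin
            (RM ▹ (U ▹ (N ▹ u))) b                              ≈⟨ ▹-cong RM (U▹N▹ u) b ⟩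
            (RM ▹ (λ c → 2# * (M ▹ w) c - (N ▹ u) c)) b         ≈⟨ ▹-minus RM (λ c → 2# * (M ▹ w) c) (N ▹ u) b ⟩
            (RM ▹ (λ c → 2# * (M ▹ w) c)) b - (RM ▹ (N ▹ u)) b  ≈⟨ +-cong (▹-scale RM 2# (M ▹ w) b) (-‿cong (reflection-▹ M (N ▹ u) b)) ⟩
            2# * (RM ▹ (M ▹ w)) b - (2# * (M ▹ w) b - (N ▹ u) b) ≈⟨ +-congʳ (*-congˡ (reflection-▹ M (M ▹ w) b)) ⟩
            2# * (2# * (M ▹ (M ᵀ ▹ (M ▹ w))) b - (M ▹ w) b) - (2# * (M ▹ w) b - (N ▹ u) b)
              ≈⟨ +-congʳ (*-congˡ (+-congʳ (*-congˡ (▹-cong M (M-isometry w) b)))) ⟩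
            2# * (2# * (M ▹ w) b - (M ▹ w) b) - (2# * (M ▹ w) b - (N ▹ u) b)
              ≈⟨ solve 2 (λ m x → con (+ 2) :* (con (+ 2) :* m :- m) :- (con (+ 2) :* m :- x) := x) refl ((M ▹ w) b) ((N ▹ u) b) ⟩
            (N ▹ u) b                                           ∎
            where
            w : Vector F
            w = M ᵀ ▹ (N ▹ u)

      -- The Chebyshev recurrence.
      B-recurrence : ∀ t u x → (B (suc (suc t)) ▹ u) x ≈ 2# * (B (suc t) ▹ (B 1 ▹ u)) x - (B t ▹ u) x
      B-recurrence t u x = begin
        (B (suc (suc t)) ▹ u) x                        ≈⟨ B▹ (suc (suc t)) u x ⟩
        (N ᵀ ▹ (U ^ᴹ suc (suc t) ▹ (N ▹ u))) x         ≈⟨ ▹-cong (N ᵀ) inner x ⟩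
        (N ᵀ ▹ (λ a → 2# * W a - (U ^ᴹ t ▹ (N ▹ u)) a)) x ≈⟨ ▹-minus (N ᵀ) (λ a → 2# * W a) (U ^ᴹ t ▹ (N ▹ u)) x ⟩
        (N ᵀ ▹ (λ a → 2# * W a)) x - (N ᵀ ▹ (U ^ᴹ t ▹ (N ▹ u))) x ≈⟨ +-cong (▹-scale (N ᵀ) 2# W x) (-‿cong (sym (B▹ t u x))) ⟩
        2# * (N ᵀ ▹ W) x - (B t ▹ u) x                 ≈⟨ +-congʳ (*-congˡ (B▹ (suc t) (B 1 ▹ u) x)) ⟨
        2# * (B (suc t) ▹ (B 1 ▹ u)) x - (B t ▹ u) x   ∎
        where
        W : Vector A
        W = U ^ᴹ suc t ▹ (N ▹ (B 1 ▹ u))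
        inner : U ^ᴹ suc (suc t) ▹ (N ▹ u) ≈ⱽ (λ a → 2# * W a - (U ^ᴹ t ▹ (N ▹ u)) a)
        inner a = begin
          (U ^ᴹ suc (suc t) ▹ (N ▹ u)) a               ≈⟨ ^ᴹ-suc (suc t) (N ▹ u) a ⟩
          (U ^ᴹ suc t ▹ (U ▹ (N ▹ u))) a               ≈⟨ ^ᴹ-suc t (U ▹ (N ▹ u)) a ⟩
          (U ^ᴹ t ▹ (U ▹ (U ▹ (N ▹ u)))) a             ≈⟨ ▹-cong (U ^ᴹ t) (U▹U▹N▹ u) a ⟩
          (U ^ᴹ t ▹ (λ b → 2# * (U ▹ (N ▹ (B 1 ▹ u))) b - (N ▹ u) b)) a ≈⟨ ▹-minus (U ^ᴹ t) (λ b → 2# * (U ▹ (N ▹ (B 1 ▹ u))) b) (N ▹ u) a ⟩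
          (U ^ᴹ t ▹ (λ b → 2# * (U ▹ (N ▹ (B 1 ▹ u))) b)) a - (U ^ᴹ t ▹ (N ▹ u)) a
            ≈⟨ +-congʳ (trans (▹-scale (U ^ᴹ t) 2# (U ▹ (N ▹ (B 1 ▹ u))) a) (*-congˡ (sym (^ᴹ-suc t (N ▹ (B 1 ▹ u)) a)))) ⟩
          2# * W a - (U ^ᴹ t ▹ (N ▹ u)) a              ∎

      -- The entries of B t in terms of the spectral decomposition of B 1.
      B-expand : (D : SpectralDecomposition (B 1)) → let open SpectralDecomposition D in
        ∀ t x y → B t x y ≈ ⅀ (λ p → T t (θ p) * E p x y)
      B-expand D t x y = begin
        B t x y                                    ≈⟨ ▹-δ (B t) y x ⟨
        (B t ▹ δ y) x                              ≈⟨ functional-calculus (λ t v → B t ▹ v) B0▹ (λ v x → refl) B-recurrence t (δ y) x ⟩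
        ⅀ (λ p → T t (θ p) * (E p ▹ δ y) x)        ≈⟨ ⅀-cong (λ p → *-congˡ (▹-δ (E p) y x)) ⟩
        ⅀ (λ p → T t (θ p) * E p x y)              ∎
        where
        open SpectralDecomposition D
        open Eigenprojections ℝ (B 1) B1-selfAdjoint
        open Decomposition D

-- Residues modulo n

module Cyclic (n : ℕ) .{{_ : NonZero n}} where

  open ℤSolver.+-*-Solver

  -- Congruence modulo n.
  infix 4 _≈ₙ_
  record _≈ₙ_ (y z : ℤ) : Set where
    constructor multiple
    field
      quotient : ℤ
      equation : y ≡ z ℤ.+ quotient ℤ.* + n

  ≈ₙ-sym : ∀ {y z} → y ≈ₙ z → z ≈ₙ y
  ≈ₙ-sym {z = z} (multiple q ≡.refl) = multiple (ℤ.- q)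
    (solve 3 (λ z q n → z := z :+ q :* n :+ (:- q) :* n) ≡.refl z q (+ n))

  ≈ₙ-trans : ∀ {x y z} → x ≈ₙ y → y ≈ₙ z → x ≈ₙ z
  ≈ₙ-trans {z = z} (multiple q ≡.refl) (multiple r ≡.refl) = multiple (r ℤ.+ q)
    (solve 4 (λ z q r n → z :+ r :* n :+ q :* n := z :+ (r :+ q) :* n) ≡.refl z q r (+ n))

  ≈ₙ-reflexive : ∀ {y z} → y ≡ z → y ≈ₙ z
  ≈ₙ-reflexive {z = z} ≡.refl = multiple 0ℤ (solve 2 (λ z n → z := z :+ con 0ℤ :* n) ≡.refl z (+ n))

  ≈ₙ-+ʳ : ∀ {y z} w → y ≈ₙ z → y ℤ.+ w ≈ₙ z ℤ.+ w
  ≈ₙ-+ʳ {z = z} w (multiple q ≡.refl) = multiple q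
    (solve 4 (λ z q n w → z :+ q :* n :+ w := z :+ w :+ q :* n) ≡.refl z q (+ n) w)

  ≈ₙ-- : ∀ {y z} w → y ≈ₙ z → w ℤ.- y ≈ₙ w ℤ.- z
  ≈ₙ-- {z = z} w (multiple q ≡.refl) = multiple (ℤ.- q)
    (solve 4 (λ z q n w → w :- (z :+ q :* n) := w :- z :+ (:- q) :* n) ≡.refl z q (+ n) w)

  private
    ∣i-k∣<n : (i k : Fin n) → ℤ.∣ + toℕ i ℤ.- + toℕ k ∣ ℕ.< n
    ∣i-k∣<n i k = ℕₚ.≤-<-trans
      (≡.subst (λ z → ℤ.∣ z ∣ ℕ.≤ toℕ i ℕ.⊔ toℕ k) (≡.sym (ℤₚ.m-n≡m⊖n (toℕ i) (toℕ k))) (ℤₚ.∣m⊝n∣≤m⊔n (toℕ i) (toℕ k)))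
      (ℕₚ.⊔-lub (Finₚ.toℕ<n i) (Finₚ.toℕ<n k))

    multiple<n⇒0 : ∀ z → (∃[ q ] z ≡ q ℤ.* + n) → ℤ.∣ z ∣ ℕ.< n → z ≡ 0ℤ
    multiple<n⇒0 z (q , z≡qn) ∣z∣<n = ℤₚ.∣i∣≡0⇒i≡0 (go ℤ.∣ z ∣ (≡.trans (≡.cong ℤ.∣_∣ z≡qn) (ℤₚ.abs-* q (+ n))) ∣z∣<n)
      where
      go : ∀ k → k ≡ ℤ.∣ q ∣ ℕ.* n → k ℕ.< n → k ≡ 0
      go zero    eq k<n = ≡.refl
      go (suc k) eq k<n = contradiction (ℕ∣.∣⇒≤ (divides ℤ.∣ q ∣ eq)) (ℕₚ.<⇒≱ k<n)

  residue-injective : {i k : Fin n} → + toℕ i ≈ₙ + toℕ k → i ≡ k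
  residue-injective {i} {k} (multiple q eq) = Finₚ.toℕ-injective (ℤₚ.+-injective (ℤₚ.i-j≡0⇒i≡j (+ toℕ i) (+ toℕ k)
    (multiple<n⇒0 _ (q , ≡.trans (≡.cong (ℤ._- + toℕ k) eq)
      (solve 2 (λ k q → k :+ q :- k := q) ≡.refl (+ toℕ k) (q ℤ.* + n))) (∣i-k∣<n i k))))

  toℕ-⊕ : (i : Fin n) (z : ℤ) → + toℕ (i ⊕ z) ≈ₙ + toℕ i ℤ.+ z
  toℕ-⊕ i z = ≈ₙ-sym (multiple (w /ℕ n) (≡.trans (a≡a%ℕn+[a/ℕn]*n w n)
    (≡.cong (λ r → + r ℤ.+ (w /ℕ n) ℤ.* + n) (≡.sym (Finₚ.toℕ-fromℕ< (n%ℕd<d w n))))))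
    where
    w : ℤ
    w = + toℕ i ℤ.+ z

  ⊕-unique : (i k : Fin n) (z : ℤ) → + toℕ i ℤ.+ z ≈ₙ + toℕ k → i ⊕ z ≡ k
  ⊕-unique i k z eq = residue-injective (≈ₙ-trans (toℕ-⊕ i z) eq)

  ⊕-multiple : (i : Fin n) (z : ℤ) → z ≈ₙ 0ℤ → i ⊕ z ≡ i
  ⊕-multiple i z (multiple q ≡.refl) = ⊕-unique i i z
    (multiple q (solve 3 (λ i q n → i :+ (con 0ℤ :+ q :* n) := i :+ q :* n) ≡.refl (+ toℕ i) q (+ n)))

  ⊕-fixed : (i : Fin n) (z : ℤ) → i ⊕ z ≡ i → z ≈ₙ 0ℤ
  ⊕-fixed i z eq = ≈ₙ-trans (≈ₙ-reflexive (solve 2 (λ i z → z := (i :+ z) :- i) ≡.refl (+ toℕ i) z))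
    (≈ₙ-trans (≈ₙ-+ʳ (ℤ.- + toℕ i) (≈ₙ-trans (≈ₙ-sym (toℕ-⊕ i z)) (≈ₙ-reflexive (≡.cong (λ k → + toℕ k) eq))))
      (≈ₙ-reflexive (ℤₚ.+-inverseʳ (+ toℕ i))))

  ⊕-identity : (i : Fin n) → i ⊕ 0ℤ ≡ i
  ⊕-identity i = ⊕-multiple i 0ℤ (≈ₙ-reflexive ≡.refl)

  ⊕-assoc : (i : Fin n) (y z : ℤ) → i ⊕ y ⊕ z ≡ i ⊕ (y ℤ.+ z)
  ⊕-assoc i y z = residue-injective (≈ₙ-trans (toℕ-⊕ (i ⊕ y) z) (≈ₙ-trans (≈ₙ-+ʳ z (toℕ-⊕ i y))
    (≈ₙ-trans (≈ₙ-reflexive (ℤₚ.+-assoc (+ toℕ i) y z)) (≈ₙ-sym (toℕ-⊕ i (y ℤ.+ z))))))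

  ⊕-inverse : (i : Fin n) (z : ℤ) → i ⊕ z ⊕ (ℤ.- z) ≡ i
  ⊕-inverse i z = ≡.trans (⊕-assoc i z (ℤ.- z)) (≡.trans (≡.cong (i ⊕_) (ℤₚ.+-inverseʳ z)) (⊕-identity i))

  ⊕-inverse′ : (i : Fin n) (z : ℤ) → i ⊕ (ℤ.- z) ⊕ z ≡ i
  ⊕-inverse′ i z = ≡.trans (⊕-assoc i (ℤ.- z) z) (≡.trans (≡.cong (i ⊕_) (ℤₚ.+-inverseˡ z)) (⊕-identity i))

  -- The reflection of ℤₙ that exchanges i and k.
  opaque
    reflect : Fin n → Fin n → Fin n → Fin n
    reflect i k b = i ⊕ (+ toℕ k ℤ.- + toℕ b)

    toℕ-reflect : ∀ i k b → + toℕ (reflect i k b) ≈ₙ (+ toℕ i ℤ.+ + toℕ k) ℤ.- + toℕ b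
    toℕ-reflect i k b = ≈ₙ-trans (toℕ-⊕ i (+ toℕ k ℤ.- + toℕ b)) (≈ₙ-reflexive (≡.sym (ℤₚ.+-assoc (+ toℕ i) (+ toℕ k) (ℤ.- + toℕ b))))

  reflect-involutive : ∀ i k b → reflect i k (reflect i k b) ≡ b
  reflect-involutive i k b = residue-injective (≈ₙ-trans (toℕ-reflect i k (reflect i k b))
    (≈ₙ-trans (≈ₙ-- (+ toℕ i ℤ.+ + toℕ k) (toℕ-reflect i k b))
      (≈ₙ-reflexive (solve 2 (λ s b → s :- (s :- b) := b) ≡.refl (+ toℕ i ℤ.+ + toℕ k) (+ toℕ b)))))

  reflect-⊕ : ∀ i k b z → reflect i k (b ⊕ z) ≡ reflect i k b ⊕ (ℤ.- z)
  reflect-⊕ i k b z = residue-injective (≈ₙ-trans (toℕ-reflect i k (b ⊕ z))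
    (≈ₙ-trans (≈ₙ-- (+ toℕ i ℤ.+ + toℕ k) (toℕ-⊕ b z))
    (≈ₙ-trans (≈ₙ-reflexive (solve 3 (λ s b z → s :- (b :+ z) := (s :- b) :+ (:- z)) ≡.refl (+ toℕ i ℤ.+ + toℕ k) (+ toℕ b) z))
      (≈ₙ-trans (≈ₙ-+ʳ (ℤ.- z) (≈ₙ-sym (toℕ-reflect i k b))) (≈ₙ-sym (toℕ-⊕ (reflect i k b) (ℤ.- z)))))))

  reflect-right : ∀ i k → reflect i k k ≡ i
  reflect-right i k = residue-injective (≈ₙ-trans (toℕ-reflect i k k)
    (≈ₙ-reflexive (solve 2 (λ i k → i :+ k :- k := i) ≡.refl (+ toℕ i) (+ toℕ k))))

  reflect-centre : ∀ i z → reflect i i (i ⊕ z) ≡ i ⊕ (ℤ.- z)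
  reflect-centre i z = ≡.trans (reflect-⊕ i i i z) (≡.cong (_⊕ (ℤ.- z)) (reflect-right i i))

  -- A nonzero offset smaller than n moves every residue.
  ⊕-moves : (i : Fin n) (z : ℤ) → z ≢ 0ℤ → ℤ.∣ z ∣ ℕ.< n → i ⊕ z ≢ i
  ⊕-moves i z z≢0 ∣z∣<n eq with ⊕-fixed i z eq
  ... | multiple q z≡ = z≢0 (multiple<n⇒0 z (q , ≡.trans z≡ (ℤₚ.+-identityˡ _)) ∣z∣<n)

-- The action of B₁ on functions on the torus

module SecondOrder {c ℓ₁ ℓ₂} (ℝ : RealNumbers c ℓ₁ ℓ₂) (k : ℕ) .{{k≢0 : NonZero k}} where

  open RealNumbers ℝ hiding (zero)
  open OrderedField ℝ
  open Cyclic k {{k≢0}} using (reflect; reflect-⊕)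
  open SetoidReasoning setoid

  -- The operator S + 2 + S⁻¹ on functions on ℤₖ, where S is the translation by 1.
  -- It is opaque: expanding it makes terms large.
  opaque
    Λ : (Fin k → Carrier) → Fin k → Carrier
    Λ φ i = φ (i ⊕ 1ℤ) + 2# * φ i + φ (i ⊕ -1ℤ)

    Λ-expand : ∀ (φ : Fin k → Carrier) i →
      Λ φ i ≈ φ (i ⊕ 1ℤ) + 2# * φ i + φ (i ⊕ -1ℤ)
    Λ-expand φ i = refl

    Λ-cong : ∀ {φ ψ : Fin k → Carrier} → (∀ i → φ i ≈ ψ i) → ∀ i → Λ φ i ≈ Λ ψ i
    Λ-cong h i = +-cong (+-cong (h _) (*-congˡ (h i))) (h _)

    Λ-scale : ∀ x (φ : Fin k → Carrier) i → Λ (λ j → x * φ j) i ≈ x * Λ φ i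
    Λ-scale x φ i = solve 4 (λ x a b c → x :* a :+ con (+ 2) :* (x :* b) :+ x :* c := x :* (a :+ con (+ 2) :* b :+ c)) refl x (φ (i ⊕ 1ℤ)) (φ i) (φ (i ⊕ -1ℤ))

  Λ-reflect : ∀ (a b : Fin k) (φ : Fin k → Carrier) i →
    Λ (λ l → φ (reflect a b l)) i ≈ Λ φ (reflect a b i)
  Λ-reflect a b φ i = begin
    Λ (λ l → φ (ρ l)) i                                ≈⟨ Λ-expand (λ l → φ (ρ l)) i ⟩
    φ (ρ (i ⊕ 1ℤ)) + 2# * φ (ρ i) + φ (ρ (i ⊕ -1ℤ))    ≈⟨ +-cong (+-congʳ (reflexive (≡.cong φ (reflect-⊕ a b i 1ℤ)))) (reflexive (≡.cong φ (reflect-⊕ a b i -1ℤ))) ⟩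
    φ (ρ i ⊕ -1ℤ) + 2# * φ (ρ i) + φ (ρ i ⊕ 1ℤ)        ≈⟨ solve 3 (λ x y z → x :+ y :+ z := z :+ y :+ x) refl _ _ _ ⟩
    φ (ρ i ⊕ 1ℤ) + 2# * φ (ρ i) + φ (ρ i ⊕ -1ℤ)        ≈⟨ Λ-expand φ (ρ i) ⟨
    Λ φ (ρ i)                                          ∎
    where
    ρ : Fin k → Fin k
    ρ = reflect a b

module GridAction {c ℓ₁ ℓ₂} (ℝ : RealNumbers c ℓ₁ ℓ₂)
  (n m : ℕ) .{{n≢0 : NonZero n}} .{{m≢0 : NonZero m}} where

  open RealNumbers ℝ hiding (zero)
  open LinearAlgebra ℝ
  open FiniteSums ℝ
  open SecondOrder ℝ n {{n≢0}} using () renaming (Λ to Λ₁)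
  open SecondOrder ℝ m {{m≢0}} using () renaming (Λ to Λ₂)

  -- P acts as (Λ₁ Λ₂) / 8 - 1, where Λ₁ and Λ₂ are the operators Λ in the two
  -- coordinates.
  ActsByΛ : Finite (Fin n × Fin m) → Matrix (Fin n × Fin m) (Fin n × Fin m) → Set _
  ActsByΛ FV P = ∀ u i j → _▹_ {{FV}} P u (i , j) ≈ ½ * (½ * (½ * Λ₁ (λ a → Λ₂ (λ b → u (a , b)) j) i)) - u (i , j)

module GridWalk {c ℓ₁ ℓ₂} (ℝ : RealNumbers c ℓ₁ ℓ₂)
  (n m : ℕ) .{{n≢0 : NonZero n}} .{{m≢0 : NonZero m}} where

  open RealNumbers ℝ hiding (zero)
  open LinearAlgebra ℝ
  open VertexFaceWalk ℝ n m {{n≢0}} {{m≢0}}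
  open OrderedField ℝ
  open FiniteSums ℝ
  open SecondOrder ℝ n {{n≢0}} using () renaming (Λ to Λ₁; Λ-expand to Λ₁-expand)
  open SecondOrder ℝ m {{m≢0}} using () renaming (Λ to Λ₂; Λ-expand to Λ₂-expand)
  open DecMembership (_≟_ {A = Arc}) using (_∈_; _∈?_)
  open SetoidReasoning setoid
  private
    module Cₙ = Cyclic n {{n≢0}}
    module Cₘ = Cyclic m {{m≢0}}

  -- The tail of the arc of direction s inside the face f is f ⊞ offset s.
  offset : Direction → ℤ × ℤ
  offset +e₁ = 0ℤ , 0ℤ
  offset +e₂ = 1ℤ , 0ℤ
  offset -e₁ = 1ℤ , 1ℤ
  offset -e₂ = 0ℤ , 1ℤ

  -- The inverse of a displacement.
  negate : ℤ × ℤ → ℤ × ℤ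
  negate (a , b) = ℤ.- a , ℤ.- b

  -- The face that contains the arc (x , s).
  face : Vertex → Direction → Face
  face x s = x ⊞ negate (offset s)

  ⊞-inverse : ∀ x d → x ⊞ d ⊞ negate d ≡ x
  ⊞-inverse (i , j) (a , b) = ≡.cong₂ _,_ (Cₙ.⊕-inverse i a) (Cₘ.⊕-inverse j b)

  ⊞-inverse′ : ∀ x d → x ⊞ negate d ⊞ d ≡ x
  ⊞-inverse′ (i , j) (a , b) = ≡.cong₂ _,_ (Cₙ.⊕-inverse′ i a) (Cₘ.⊕-inverse′ j b)

  private
    ⊞-identity : ∀ f → f ⊞ (0ℤ , 0ℤ) ≡ f
    ⊞-identity (i , j) = ≡.cong₂ _,_ (Cₙ.⊕-identity i) (Cₘ.⊕-identity j)

    opposite : ∀ f → f ⊞ step +e₁ ⊞ step +e₂ ≡ f ⊞ (1ℤ , 1ℤ)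
    opposite (i , j) = ≡.cong₂ _,_ (Cₙ.⊕-assoc i 1ℤ 0ℤ) (Cₘ.⊕-assoc j 0ℤ 1ℤ)

  ∈boundary⇒ : ∀ {x s} f → (x , s) ∈ boundary f → x ≡ f ⊞ offset s
  ∈boundary⇒ f (here ≡.refl)                         = ≡.sym (⊞-identity f)
  ∈boundary⇒ f (there (here ≡.refl))                 = ≡.refl
  ∈boundary⇒ f (there (there (here ≡.refl)))         = opposite f
  ∈boundary⇒ f (there (there (there (here ≡.refl)))) = ≡.refl

  ⇒∈boundary : ∀ f s → (f ⊞ offset s , s) ∈ boundary f
  ⇒∈boundary f +e₁ = here (≡.cong (_, +e₁) (⊞-identity f))
  ⇒∈boundary f +e₂ = there (here ≡.refl)
  ⇒∈boundary f -e₁ = there (there (here (≡.cong (_, -e₁) (≡.sym (opposite f)))))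
  ⇒∈boundary f -e₂ = there (there (there (here ≡.refl)))

  ⅀-Direction : (g : Direction → Carrier) → ⅀ g ≈ g +e₁ + g -e₁ + g +e₂ + g -e₂
  ⅀-Direction g = trans (⅀≈∑ g) (solve 4 (λ a b c d → a :+ (b :+ (c :+ (d :+ con 0ℤ))) := a :+ b :+ c :+ d) refl (g +e₁) (g -e₁) (g +e₂) (g -e₂))

  ⅀-Arc : (g : Arc → Carrier) → ⅀ g ≈ ⅀ (λ s → ⅀ (λ x → g (x , s)))
  ⅀-Arc g = trans (⅀-product ×-finite g) (⅀-comm (λ x s → g (x , s)))

  N▹ : ∀ u x s → (N ▹ u) (x , s) ≈ ½ * u x
  N▹ u x s = trans
    (⅀-single _ x λ y y≢x → trans (*-congʳ (if-no (y ≟ x) y≢x)) (zeroˡ _))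
    (*-congʳ (if-yes (x ≟ x) ≡.refl))

  Nᵀ▹ : ∀ v x → (N ᵀ ▹ v) x ≈ ½ * ⅀ (λ s → v (x , s))
  Nᵀ▹ v x = begin
    ⅀ (λ a → N a x * v a)                          ≈⟨ ⅀-Arc (λ a → N a x * v a) ⟩
    ⅀ (λ s → ⅀ (λ y → N (y , s) x * v (y , s)))    ≈⟨ ⅀-cong (λ s → ⅀-single _ x λ y y≢x → trans (*-congʳ (if-no (x ≟ y) λ x≡y → y≢x (≡.sym x≡y))) (zeroˡ _)) ⟩
    ⅀ (λ s → N (x , s) x * v (x , s))              ≈⟨ ⅀-cong (λ s → *-congʳ (if-yes (x ≟ x) ≡.refl)) ⟩
    ⅀ (λ s → ½ * v (x , s))                        ≈⟨ ⅀-*ˡ ½ (λ s → v (x , s)) ⟩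
    ½ * ⅀ (λ s → v (x , s))                        ∎

  M▹ : ∀ w x s → (M ▹ w) (x , s) ≈ ½ * w (face x s)
  M▹ w x s = trans
    (⅀-single _ (face x s) λ f f≢ → trans (*-congʳ (if-no ((x , s) ∈? boundary f)
      λ a∈ → f≢ (≡.trans (≡.sym (⊞-inverse f (offset s))) (≡.cong (λ y → face y s) (≡.sym (∈boundary⇒ f a∈)))))) (zeroˡ _))
    (*-congʳ (if-yes ((x , s) ∈? boundary (face x s))
      (≡.subst (λ y → (y , s) ∈ boundary (face x s)) (⊞-inverse′ x (offset s)) (⇒∈boundary (face x s) s))))

  Mᵀ▹ : ∀ v f → (M ᵀ ▹ v) f ≈ ½ * ⅀ (λ s → v (f ⊞ offset s , s))
  Mᵀ▹ v f = begin
    ⅀ (λ a → M a f * v a)                                          ≈⟨ ⅀-Arc (λ a → M a f * v a) ⟩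
    ⅀ (λ s → ⅀ (λ x → M (x , s) f * v (x , s)))                    ≈⟨ ⅀-cong (λ s → ⅀-single _ (f ⊞ offset s) λ x x≢ → trans (*-congʳ (if-no ((x , s) ∈? boundary f) λ a∈ → x≢ (∈boundary⇒ f a∈))) (zeroˡ _)) ⟩
    ⅀ (λ s → M (f ⊞ offset s , s) f * v (f ⊞ offset s , s))        ≈⟨ ⅀-cong (λ s → *-congʳ (if-yes ((f ⊞ offset s , s) ∈? boundary f) (⇒∈boundary f s))) ⟩
    ⅀ (λ s → ½ * v (f ⊞ offset s , s))                             ≈⟨ ⅀-*ˡ ½ (λ s → v (f ⊞ offset s , s)) ⟩
    ½ * ⅀ (λ s → v (f ⊞ offset s , s))                             ∎

  private
    four-quarters : ∀ x → ½ * (½ * x + ½ * x + ½ * x + ½ * x) ≈ x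
    four-quarters x = begin
      ½ * (½ * x + ½ * x + ½ * x + ½ * x)   ≈⟨ solve 2 (λ h x → h :* (h :* x :+ h :* x :+ h :* x :+ h :* x) := (h :* con (+ 2)) :* ((h :* con (+ 2)) :* x)) refl ½ x ⟩
      (½ * 2#) * ((½ * 2#) * x)             ≈⟨ *-cong ½*2≈1 (*-congʳ ½*2≈1) ⟩
      1# * (1# * x)                         ≈⟨ trans (*-identityˡ _) (*-identityˡ _) ⟩
      x                                     ∎

    average : ∀ {g : Direction → Carrier} x → (∀ s → g s ≈ ½ * x) → ½ * ⅀ g ≈ x
    average {g} x h = trans (*-congˡ (trans (⅀-cong h) (⅀-Direction (λ _ → ½ * x)))) (four-quarters x)

  N-isometry : ∀ u → N ᵀ ▹ (N ▹ u) ≈ⱽ u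
  N-isometry u x = trans (Nᵀ▹ (N ▹ u) x) (average (u x) (N▹ u x))

  M-isometry : ∀ w → M ᵀ ▹ (M ▹ w) ≈ⱽ w
  M-isometry w f = trans (Mᵀ▹ (M ▹ w) f) (average (w f) λ s →
    trans (M▹ w (f ⊞ offset s) s) (*-congˡ (reflexive (≡.cong w (⊞-inverse f (offset s))))))

  -- (B₁ u) x = (∑ u (x - offset s + offset r)) / 8 - u x, the sum being over the
  -- sixteen pairs of directions s and r, and these displacements are the terms of
  -- the product (S₁ + 2 + S₁⁻¹) (S₂ + 2 + S₂⁻¹).
  B1▹-Λ : GridAction.ActsByΛ ℝ n m {{n≢0}} {{m≢0}} ×-finite (B 1)
  B1▹-Λ u i j = begin
    (B 1 ▹ u) x                                               ≈⟨ B1▹ N-isometry u x ⟩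
    2# * (N ᵀ ▹ (M ▹ K)) x - u x                              ≈⟨ +-congʳ (*-congˡ (trans (Nᵀ▹ (M ▹ K) x) (*-congˡ (⅀-cong λ s → trans (M▹ K x s) (*-congˡ (K≈ (face x s))))))) ⟩
    2# * (½ * ⅀ (λ s → ½ * (½ * ⅀ (λ r → ½ * u (face x s ⊞ offset r))))) - u x
                                                              ≈⟨ +-congʳ (*-congˡ (*-congˡ expand)) ⟩
    2# * (½ * (½ * (½ * (½ * sixteen)))) - u x                ≈⟨ +-congʳ halve ⟩
    ½ * (½ * (½ * sixteen)) - u x                             ≈⟨ +-congʳ (*-congˡ (*-congˡ (*-congˡ collect))) ⟩
    ½ * (½ * (½ * Λ₁ (λ a → Λ₂ (λ b → u (a , b)) j) i)) - u x   ∎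
    where
    open TwoReflections ℝ N M using (B1▹)
    x : Vertex
    x = i , j
    K : Vector Face
    K = M ᵀ ▹ (N ▹ u)
    K≈ : ∀ f → K f ≈ ½ * ⅀ (λ r → ½ * u (f ⊞ offset r))
    K≈ f = trans (Mᵀ▹ (N ▹ u) f) (*-congˡ (⅀-cong λ r → N▹ u (f ⊞ offset r) r))
    -- The value of u at the vertex with displacement (a , b) from x.
    at : ℤ → ℤ → Carrier
    at a b = u (i ⊕ a , j ⊕ b)
    -- The four terms with a given s.
    row : Direction → Carrier
    row s = at (a₁ ℤ.+ 0ℤ) (b₁ ℤ.+ 0ℤ) + at (a₁ ℤ.+ 1ℤ) (b₁ ℤ.+ 1ℤ) + at (a₁ ℤ.+ 1ℤ) (b₁ ℤ.+ 0ℤ) + at (a₁ ℤ.+ 0ℤ) (b₁ ℤ.+ 1ℤ)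
      where
      a₁ b₁ : ℤ
      a₁ = proj₁ (negate (offset s))
      b₁ = proj₂ (negate (offset s))
    sixteen : Carrier
    sixteen = row +e₁ + row -e₁ + row +e₂ + row -e₂
    at-face : ∀ s r → u (face x s ⊞ offset r) ≈
      at (proj₁ (negate (offset s)) ℤ.+ proj₁ (offset r)) (proj₂ (negate (offset s)) ℤ.+ proj₂ (offset r))
    at-face s r = reflexive (≡.cong₂ (λ a b → u (a , b)) (Cₙ.⊕-assoc i (proj₁ (negate (offset s))) (proj₁ (offset r))) (Cₘ.⊕-assoc j (proj₂ (negate (offset s))) (proj₂ (offset r))))
    inner : ∀ s → ½ * (½ * ⅀ (λ r → ½ * u (face x s ⊞ offset r))) ≈ ½ * (½ * (½ * row s))
    inner s = *-congˡ (*-congˡ (trans (⅀-*ˡ ½ (λ r → u (face x s ⊞ offset r)))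
      (*-congˡ (trans (⅀-cong (at-face s)) (⅀-Direction _)))))
    expand : ⅀ (λ s → ½ * (½ * ⅀ (λ r → ½ * u (face x s ⊞ offset r)))) ≈ ½ * (½ * (½ * sixteen))
    expand = begin
      ⅀ (λ s → ½ * (½ * ⅀ (λ r → ½ * u (face x s ⊞ offset r))))  ≈⟨ ⅀-cong inner ⟩
      ⅀ (λ s → ½ * (½ * (½ * row s)))                            ≈⟨ ⅀-*ˡ ½ (λ s → ½ * (½ * row s)) ⟩
      ½ * ⅀ (λ s → ½ * (½ * row s))                              ≈⟨ *-congˡ (⅀-*ˡ ½ (λ s → ½ * row s)) ⟩
      ½ * (½ * ⅀ (λ s → ½ * row s))                              ≈⟨ *-congˡ (*-congˡ (⅀-*ˡ ½ row)) ⟩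
      ½ * (½ * (½ * ⅀ row))                                      ≈⟨ *-congˡ (*-congˡ (*-congˡ (⅀-Direction row))) ⟩
      ½ * (½ * (½ * sixteen))                                    ∎
    halve : 2# * (½ * (½ * (½ * (½ * sixteen)))) ≈ ½ * (½ * (½ * sixteen))
    halve = begin
      2# * (½ * (½ * (½ * (½ * sixteen))))   ≈⟨ solve 2 (λ h y → con (+ 2) :* (h :* y) := (h :* con (+ 2)) :* y) refl ½ (½ * (½ * (½ * sixteen))) ⟩
      ½ * 2# * (½ * (½ * (½ * sixteen)))     ≈⟨ *-congʳ ½*2≈1 ⟩
      1# * (½ * (½ * (½ * sixteen)))         ≈⟨ *-identityˡ _ ⟩
      ½ * (½ * (½ * sixteen))                ∎
    collect : sixteen ≈ Λ₁ (λ a → Λ₂ (λ b → u (a , b)) j) i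
    collect = trans
      (solve 9 (λ z₀₀ z₀₊ z₀₋ z₊₀ z₊₊ z₊₋ z₋₀ z₋₊ z₋₋ →
        (z₀₀ :+ z₊₊ :+ z₊₀ :+ z₀₊) :+ (z₋₋ :+ z₀₀ :+ z₀₋ :+ z₋₀) :+ (z₋₀ :+ z₀₊ :+ z₀₀ :+ z₋₊) :+ (z₀₋ :+ z₊₀ :+ z₊₋ :+ z₀₀)
        := (z₊₊ :+ con (+ 2) :* z₊₀ :+ z₊₋) :+ con (+ 2) :* (z₀₊ :+ con (+ 2) :* z₀₀ :+ z₀₋) :+ (z₋₊ :+ con (+ 2) :* z₋₀ :+ z₋₋))
        refl (at 0ℤ 0ℤ) (at 0ℤ 1ℤ) (at 0ℤ -1ℤ) (at 1ℤ 0ℤ) (at 1ℤ 1ℤ) (at 1ℤ -1ℤ) (at -1ℤ 0ℤ) (at -1ℤ 1ℤ) (at -1ℤ -1ℤ))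
      (sym (trans (Λ₁-expand (λ a → Λ₂ (λ b → u (a , b)) j) i)
        (+-cong (+-cong (row-expand (i ⊕ 1ℤ)) (*-congˡ row-expand′)) (row-expand (i ⊕ -1ℤ)))))
      where
      i₀ : ∀ b → u (i ⊕ 0ℤ , b) ≈ u (i , b)
      i₀ b = reflexive (≡.cong (λ a → u (a , b)) (Cₙ.⊕-identity i))
      j₀ : ∀ a → u (a , j ⊕ 0ℤ) ≈ u (a , j)
      j₀ a = reflexive (≡.cong (λ b → u (a , b)) (Cₘ.⊕-identity j))
      row-expand : ∀ a → Λ₂ (λ b → u (a , b)) j ≈ u (a , j ⊕ 1ℤ) + 2# * u (a , j ⊕ 0ℤ) + u (a , j ⊕ -1ℤ)
      row-expand a = trans (Λ₂-expand (λ b → u (a , b)) j) (+-congʳ (+-congˡ (*-congˡ (sym (j₀ a)))))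
      row-expand′ : Λ₂ (λ b → u (i , b)) j ≈ at 0ℤ 1ℤ + 2# * at 0ℤ 0ℤ + at 0ℤ -1ℤ
      row-expand′ = trans (row-expand i) (sym (+-cong (+-cong (i₀ _) (*-congˡ (i₀ _))) (i₀ _)))

-- The entries of the eigenprojections

module EvenSequence {c ℓ₁ ℓ₂} (ℝ : RealNumbers c ℓ₁ ℓ₂) where

  open RealNumbers ℝ hiding (zero)
  open OrderedField ℝ
  open Chebyshev ℝ
  open SetoidReasoning setoid

  -- An even two-sided sequence that satisfies the recurrence of the cosine,
  -- f (z + 1) + f (z - 1) = 2 θ f z.
  module Cosine (θ : Carrier) (f : ℤ → Carrier)
    (even : ∀ z → f (ℤ.- z) ≈ f z)
    (recurrence : ∀ z → f (z ℤ.+ 1ℤ) + f (z ℤ.+ -1ℤ) ≈ 2# * (θ * f z))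
    where

    private
      module S = ℤSolver.+-*-Solver

      f-≡ : ∀ {y z} → y ≡ z → f y ≈ f z
      f-≡ eq = reflexive (≡.cong f eq)

    T-product : ∀ t z → f (z ℤ.+ + t) + f (z ℤ.- + t) ≈ 2# * (T t θ * f z)
    T-product zero z = begin
      f (z ℤ.+ 0ℤ) + f (z ℤ.+ 0ℤ)   ≈⟨ +-cong (f-≡ (ℤₚ.+-identityʳ z)) (f-≡ (ℤₚ.+-identityʳ z)) ⟩
      f z + f z                     ≈⟨ solve 1 (λ x → x :+ x := con (+ 2) :* (con 1ℤ :* x)) refl (f z) ⟩
      2# * (1# * f z)               ∎
    T-product (suc zero) z = recurrence z
    T-product (suc (suc t)) z = begin
      a⁺ + a⁻                                               ≈⟨ solve 4 (λ a a′ b b′ → a :+ a′ := (a :+ b) :+ (b′ :+ a′) :- (b :+ b′)) refl a⁺ a⁻ b⁺ b⁻ ⟩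
      (a⁺ + b⁺) + (b⁻ + a⁻) - (b⁺ + b⁻)                     ≈⟨ +-cong (+-cong rec⁺ rec⁻) (-‿cong (T-product t z)) ⟩
      2# * (θ * c⁺) + 2# * (θ * c⁻) - 2# * (T t θ * f z)    ≈⟨ solve 4 (λ θ c c′ y → con (+ 2) :* (θ :* c) :+ con (+ 2) :* (θ :* c′) :- y := con (+ 2) :* (θ :* (c :+ c′)) :- y) refl θ c⁺ c⁻ (2# * (T t θ * f z)) ⟩
      2# * (θ * (c⁺ + c⁻)) - 2# * (T t θ * f z)             ≈⟨ +-congʳ (*-congˡ (*-congˡ (T-product (suc t) z))) ⟩
      2# * (θ * (2# * (T (suc t) θ * f z))) - 2# * (T t θ * f z)
        ≈⟨ solve 4 (λ θ u v y → con (+ 2) :* (θ :* (con (+ 2) :* (u :* y))) :- con (+ 2) :* (v :* y) := con (+ 2) :* ((con (+ 2) :* (θ :* u) :- v) :* y)) refl θ (T (suc t) θ) (T t θ) (f z) ⟩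
      2# * (T (suc (suc t)) θ * f z)                        ∎
      where
      a⁺ a⁻ b⁺ b⁻ c⁺ c⁻ : Carrier
      a⁺ = f (z ℤ.+ + suc (suc t))
      a⁻ = f (z ℤ.- + suc (suc t))
      b⁺ = f (z ℤ.+ + t)
      b⁻ = f (z ℤ.- + t)
      c⁺ = f (z ℤ.+ + suc t)
      c⁻ = f (z ℤ.- + suc t)
      rec⁺ : a⁺ + b⁺ ≈ 2# * (θ * c⁺)
      rec⁺ = trans (+-cong
        (f-≡ (S.solve 2 (λ z t → z S.:+ (S.con (+ 2) S.:+ t) S.:= z S.:+ (S.con 1ℤ S.:+ t) S.:+ S.con 1ℤ) ≡.refl z (+ t)))
        (f-≡ (S.solve 2 (λ z t → z S.:+ t S.:= z S.:+ (S.con 1ℤ S.:+ t) S.:+ S.con -1ℤ) ≡.refl z (+ t))))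
        (recurrence (z ℤ.+ + suc t))
      rec⁻ : b⁻ + a⁻ ≈ 2# * (θ * c⁻)
      rec⁻ = trans (+-cong
        (f-≡ (S.solve 2 (λ z t → z S.:- t S.:= z S.:- (S.con 1ℤ S.:+ t) S.:+ S.con 1ℤ) ≡.refl z (+ t)))
        (f-≡ (S.solve 2 (λ z t → z S.:- (S.con (+ 2) S.:+ t) S.:= z S.:- (S.con 1ℤ S.:+ t) S.:+ S.con -1ℤ) ≡.refl z (+ t))))
        (recurrence (z ℤ.- + suc t))

    T*f[0] : ∀ t → T t θ * f 0ℤ ≈ f (+ t)
    T*f[0] t = sym (double-injective (begin
      f (+ t) + f (+ t)              ≈⟨ +-congˡ (even (+ t)) ⟨
      f (+ t) + f (ℤ.- + t)          ≈⟨ +-cong (f-≡ (ℤₚ.+-identityˡ (+ t))) (f-≡ (ℤₚ.+-identityˡ (ℤ.- + t))) ⟨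
      f (0ℤ ℤ.+ + t) + f (0ℤ ℤ.- + t) ≈⟨ T-product t 0ℤ ⟩
      2# * (T t θ * f 0ℤ)            ≈⟨ solve 1 (λ x → con (+ 2) :* x := x :+ x) refl (T t θ * f 0ℤ) ⟩
      T t θ * f 0ℤ + T t θ * f 0ℤ    ∎))

    2T*f[t] : ∀ t → 2# * (T t θ * f (+ t)) ≈ f (+ t ℤ.+ + t) + f 0ℤ
    2T*f[t] t = trans (sym (T-product t (+ t))) (+-congˡ (f-≡ (ℤₚ.+-inverseʳ (+ t))))

    -- If 4 t is a period, then f (3 t) = f (- 3 t) = f t.
    T*T*f[t] : ∀ t → f (+ t ℤ.- + (4 ℕ.* t)) ≈ f (+ t) → T t θ * (T t θ * f (+ t)) ≈ f (+ t)
    T*T*f[t] t period = double-injective (double-injective (begin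
      (y + y) + (y + y)                                       ≈⟨ solve 2 (λ s x → (s :* (s :* x) :+ s :* (s :* x)) :+ (s :* (s :* x) :+ s :* (s :* x)) := con (+ 2) :* (s :* (con (+ 2) :* (s :* x)))) refl (T t θ) (f (+ t)) ⟩
      2# * (T t θ * (2# * (T t θ * f (+ t))))                 ≈⟨ *-congˡ (*-congˡ (2T*f[t] t)) ⟩
      2# * (T t θ * (f (+ t ℤ.+ + t) + f 0ℤ))                 ≈⟨ solve 3 (λ s x y → con (+ 2) :* (s :* (x :+ y)) := con (+ 2) :* (s :* x) :+ (s :* y :+ s :* y)) refl (T t θ) (f (+ t ℤ.+ + t)) (f 0ℤ) ⟩
      2# * (T t θ * f (+ t ℤ.+ + t)) + (T t θ * f 0ℤ + T t θ * f 0ℤ)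
        ≈⟨ +-cong (trans (sym (T-product t (+ t ℤ.+ + t))) (+-cong f3t≈ (f-≡ (S.solve 1 (λ t → t S.:+ t S.:- t S.:= t) ≡.refl (+ t))))) (+-cong (T*f[0] t) (T*f[0] t)) ⟩
      (f (+ t) + f (+ t)) + (f (+ t) + f (+ t))               ∎))
      where
      y : Carrier
      y = T t θ * (T t θ * f (+ t))
      f3t≈ : f (+ t ℤ.+ + t ℤ.+ + t) ≈ f (+ t)
      f3t≈ = begin
        f (+ t ℤ.+ + t ℤ.+ + t)              ≈⟨ even _ ⟨
        f (ℤ.- (+ t ℤ.+ + t ℤ.+ + t))        ≈⟨ f-≡ (≡.trans (S.solve 1 (λ t → S.:- (t S.:+ t S.:+ t) S.:= t S.:- S.con (+ 4) S.:* t) ≡.refl (+ t))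
                                                  (≡.cong (λ w → + t ℤ.- w) (≡.sym (ℤₚ.pos-* 4 t)))) ⟩
        f (+ t ℤ.- + (4 ℕ.* t))              ≈⟨ period ⟩
        f (+ t)                              ∎

-- A named instance, so that all residues modulo 4 carry the same one.
4≢0 : NonZero 4
4≢0 = ℕ.nonZero

-- The spectral properties of an operator P with the action of B₁.  They do not
-- depend on the enumeration FV of the vertices, which is therefore arbitrary.
module TorusSpectrum {c ℓ₁ ℓ₂} (ℝ : RealNumbers c ℓ₁ ℓ₂) (n : ℕ) .{{n≢0 : NonZero n}}
  (FV : Finite (Fin 4 × Fin n))
  (P : LinearAlgebra.Matrix ℝ (Fin 4 × Fin n) (Fin 4 × Fin n))
  (selfAdjoint : FiniteSums.SelfAdjoint ℝ {{FV}} P)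
  (P▹-Λ : GridAction.ActsByΛ ℝ 4 n {{4≢0}} {{n≢0}} FV P)
  where

  open RealNumbers ℝ hiding (zero)
  open LinearAlgebra ℝ
  open OrderedField ℝ
  open Chebyshev ℝ
  open SetoidReasoning setoid
  private
    module C₄ = Cyclic 4 {{4≢0}}
    module Cₙ = Cyclic n {{n≢0}}

  Vertex : Set
  Vertex = Fin 4 × Fin n

  open Eigenprojections ℝ {Vertex} {{FV}} P selfAdjoint
  open SecondOrder ℝ 4 {{4≢0}} using () renaming (Λ to Λ₁; Λ-expand to Λ₁-expand; Λ-cong to Λ₁-cong; Λ-scale to Λ₁-scale; Λ-reflect to Λ₁-reflect)
  open SecondOrder ℝ n {{n≢0}} using () renaming (Λ to Λ₂; Λ-expand to Λ₂-expand; Λ-scale to Λ₂-scale; Λ-reflect to Λ₂-reflect)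
  open FiniteSums ℝ using (_≈ⱽ_; ⅀; ⅀≈∑; ⅀-cong; ⅀-single; ⅀-product; if-yes; if-no)
  open FiniteSums.Action ℝ {Vertex} {Vertex} {{FV}}
  open FiniteSums.InnerProduct ℝ {Vertex} {{FV}}

  infixl 7 _▹_
  _▹_ : Matrix Vertex Vertex → Vector Vertex → Vector Vertex
  Q ▹ v = FiniteSums._▹_ ℝ {{FV}} Q v

  infix 6.5 _∙_
  _∙_ : Vector Vertex → Vector Vertex → Carrier
  v ∙ w = FiniteSums._∙_ ℝ {{FV}} v w

  δ : Vertex → Vector Vertex
  δ = FiniteSums.δ ℝ {{FV}}

  infixl 6 _⊕₁_ _⊕₂_
  _⊕₁_ : Fin 4 → ℤ → Fin 4
  i ⊕₁ z = i ⊕ z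

  _⊕₂_ : Fin n → ℤ → Fin n
  j ⊕₂ z = j ⊕ z

  private
    -- The Kronecker symbol on ℤₙ.
    [_≡_] : Fin n → Fin n → Carrier
    [ a ≡ b ] = 1ᴹ a b

  private
    1ᴹ-⇔ : ∀ {a b c d : Fin n} → (a ≡ b → c ≡ d) → (c ≡ d → a ≡ b) → [ a ≡ b ] ≈ [ c ≡ d ]
    1ᴹ-⇔ {a} {b} {c} {d} to from with a ≟ b | c ≟ d
    ... | yes _   | yes _   = refl
    ... | no _    | no _    = refl
    ... | yes a≡b | no c≢d  = contradiction (to a≡b) c≢d
    ... | no a≢b  | yes c≡d = contradiction (from c≡d) a≢b

    0≤1ᴹ : ∀ (a b : Fin n) → 0# ≤ [ a ≡ b ]
    0≤1ᴹ a b with a ≟ b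
    ... | yes _ = <⇒≤ 0<1
    ... | no _  = ≈⇒≤ refl

  -- The indicator of ℤ₄ × {b}, a cycle of length 4.
  circle : Fin n → Vector Vertex
  circle b (_ , b′) = [ b′ ≡ b ]

  -- The character of frequency 2 of ℤ₄.
  alternating : Fin 4 → Carrier
  alternating 0F = 1#
  alternating 1F = - 1#
  alternating 2F = 1#
  alternating 3F = - 1#

  -- The indicator of ℤ₄ × {b} with alternating signs.
  alternatingCircle : Fin n → Vector Vertex
  alternatingCircle b (a , b′) = alternating a * [ b′ ≡ b ]

  alternating² : ∀ i x → alternating i * (alternating i * x) ≈ x
  alternating² 0F x = solve 1 (λ x → con 1ℤ :* (con 1ℤ :* x) := x) refl x
  alternating² 1F x = solve 1 (λ x → (:- con 1ℤ) :* ((:- con 1ℤ) :* x) := x) refl x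
  alternating² 2F x = solve 1 (λ x → con 1ℤ :* (con 1ℤ :* x) := x) refl x
  alternating² 3F x = solve 1 (λ x → (:- con 1ℤ) :* ((:- con 1ℤ) :* x) := x) refl x

  -- On functions of the second coordinate, Λ₁ = 4 and P = (S + S⁻¹) / 2.
  P▹circle : ∀ b → P ▹ circle b ≈ⱽ (λ x → ½ * (circle (b ⊕₂ 1ℤ) x + circle (b ⊕₂ -1ℤ) x))
  P▹circle b (i , j) = begin
    (P ▹ circle b) (i , j)                              ≈⟨ trans (P▹-Λ (circle b) i j) (+-congʳ (*-congˡ (*-congˡ (*-congˡ (trans (Λ₁-expand (λ _ → Λ₂ (λ b′ → [ b′ ≡ b ]) j) i) (+-cong (+-cong Λ≈X (*-congˡ Λ≈X)) Λ≈X)))))) ⟩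
    ½ * (½ * (½ * (X + 2# * X + X))) - [ j ≡ b ]             ≈⟨ +-congʳ (*-congˡ (*-congˡ (*-congˡ (solve 1 (λ x → x :+ con (+ 2) :* x :+ x := (x :+ x) :+ (x :+ x)) refl X)))) ⟩
    ½ * (½ * (½ * ((X + X) + (X + X)))) - [ j ≡ b ]          ≈⟨ +-congʳ (*-congˡ (trans (*-congˡ (½*[x+x]≈x (X + X))) (½*[x+x]≈x X))) ⟩
    ½ * X - [ j ≡ b ]                                        ≈⟨ +-congˡ (-‿cong (½*[x+x]≈x ([ j ≡ b ]))) ⟨
    ½ * X - ½ * ([ j ≡ b ] + [ j ≡ b ])                         ≈⟨ solve 4 (λ h p y q → h :* (p :+ con (+ 2) :* y :+ q) :- h :* (y :+ y) := h :* (q :+ p)) refl ½ ([ j ⊕₂ 1ℤ ≡ b ]) ([ j ≡ b ]) ([ j ⊕₂ -1ℤ ≡ b ]) ⟩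
    ½ * ([ j ⊕₂ -1ℤ ≡ b ] + [ j ⊕₂ 1ℤ ≡ b ])                  ≈⟨ *-congˡ (+-cong (shift -1ℤ) (shift 1ℤ)) ⟩
    ½ * ([ j ≡ b ⊕₂ 1ℤ ] + [ j ≡ b ⊕₂ -1ℤ ])                  ∎
    where
    X : Carrier
    X = [ j ⊕₂ 1ℤ ≡ b ] + 2# * [ j ≡ b ] + [ j ⊕₂ -1ℤ ≡ b ]
    Λ≈X : Λ₂ (λ b′ → [ b′ ≡ b ]) j ≈ X
    Λ≈X = Λ₂-expand (λ b′ → [ b′ ≡ b ]) j
    shift : ∀ z → [ j ⊕₂ z ≡ b ] ≈ [ j ≡ b ⊕₂ (ℤ.- z) ]
    shift z = 1ᴹ-⇔ (λ { ≡.refl → ≡.sym (Cₙ.⊕-inverse j z) }) (λ { ≡.refl → Cₙ.⊕-inverse′ b z })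

  -- Λ₁ annihilates the alternating character.
  alternatingCircle-eigen : ∀ b → Eigen (- 1#) (alternatingCircle b)
  alternatingCircle-eigen b (i , j) = begin
    (P ▹ alternatingCircle b) (i , j)                   ≈⟨ P▹-Λ (alternatingCircle b) i j ⟩
    ½ * (½ * (½ * Λ₁ (λ a → Λ₂ (λ b′ → alternating a * [ b′ ≡ b ]) j) i)) - alternatingCircle b (i , j)
      ≈⟨ +-congʳ (*-congˡ (*-congˡ (*-congˡ (trans (Λ₁-cong (λ a → trans (Λ₂-scale (alternating a) (λ b′ → [ b′ ≡ b ]) j) (*-comm _ _)) i) (Λ₁-scale X alternating i))))) ⟩
    ½ * (½ * (½ * (X * Λ₁ alternating i))) - alternatingCircle b (i , j)
      ≈⟨ +-congʳ (*-congˡ (*-congˡ (*-congˡ (*-congˡ (Λ-alternating i))))) ⟩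
    ½ * (½ * (½ * (X * 0#))) - alternatingCircle b (i , j)
      ≈⟨ solve 3 (λ h x y → h :* (h :* (h :* (x :* con 0ℤ))) :- y := (:- con 1ℤ) :* y) refl ½ X (alternatingCircle b (i , j)) ⟩
    - 1# * alternatingCircle b (i , j)                    ∎
    where
    X : Carrier
    X = Λ₂ (λ b′ → [ b′ ≡ b ]) j
    Λ-alternating : ∀ i → Λ₁ alternating i ≈ 0#
    Λ-alternating 0F = trans (Λ₁-expand alternating 0F) (solve 0 ((:- con 1ℤ) :+ con (+ 2) :* con 1ℤ :+ (:- con 1ℤ) := con 0ℤ) refl)
    Λ-alternating 1F = trans (Λ₁-expand alternating 1F) (solve 0 (con 1ℤ :+ con (+ 2) :* (:- con 1ℤ) :+ con 1ℤ := con 0ℤ) refl)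
    Λ-alternating 2F = trans (Λ₁-expand alternating 2F) (solve 0 ((:- con 1ℤ) :+ con (+ 2) :* con 1ℤ :+ (:- con 1ℤ) := con 0ℤ) refl)
    Λ-alternating 3F = trans (Λ₁-expand alternating 3F) (solve 0 (con 1ℤ :+ con (+ 2) :* (:- con 1ℤ) :+ con 1ℤ := con 0ℤ) refl)

  -- The reflections of the torus in one coordinate that exchange a and b.
  reflect₁ : Fin 4 → Fin 4 → Vertex → Vertex
  reflect₁ a b (i , j) = C₄.reflect a b i , j

  reflect₂ : Fin n → Fin n → Vertex → Vertex
  reflect₂ a b (i , j) = i , Cₙ.reflect a b j

  P▹-reflect₁ : ∀ a b u → P ▹ (λ y → u (reflect₁ a b y)) ≈ⱽ (λ y → (P ▹ u) (reflect₁ a b y))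
  P▹-reflect₁ a b u (i , j) = begin
    (P ▹ (λ y → u (reflect₁ a b y))) (i , j)        ≈⟨ P▹-Λ (λ y → u (reflect₁ a b y)) i j ⟩
    ½ * (½ * (½ * Λ₁ (λ k → Λ₂ (λ l → u (C₄.reflect a b k , l)) j) i)) - u (C₄.reflect a b i , j)
      ≈⟨ +-congʳ (*-congˡ (*-congˡ (*-congˡ (Λ₁-reflect a b (λ k → Λ₂ (λ l → u (k , l)) j) i)))) ⟩
    ½ * (½ * (½ * Λ₁ (λ k → Λ₂ (λ l → u (k , l)) j) (C₄.reflect a b i))) - u (C₄.reflect a b i , j)
      ≈⟨ P▹-Λ u (C₄.reflect a b i) j ⟨
    (P ▹ u) (C₄.reflect a b i , j)          ∎

  P▹-reflect₂ : ∀ a b u → P ▹ (λ y → u (reflect₂ a b y)) ≈ⱽ (λ y → (P ▹ u) (reflect₂ a b y))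
  P▹-reflect₂ a b u (i , j) = begin
    (P ▹ (λ y → u (reflect₂ a b y))) (i , j)        ≈⟨ P▹-Λ (λ y → u (reflect₂ a b y)) i j ⟩
    ½ * (½ * (½ * Λ₁ (λ k → Λ₂ (λ l → u (k , Cₙ.reflect a b l)) j) i)) - u (i , Cₙ.reflect a b j)
      ≈⟨ +-congʳ (*-congˡ (*-congˡ (*-congˡ (Λ₁-cong (λ k → Λ₂-reflect a b (λ l → u (k , l)) j) i)))) ⟩
    ½ * (½ * (½ * Λ₁ (λ k → Λ₂ (λ l → u (k , l)) (Cₙ.reflect a b j)) i)) - u (i , Cₙ.reflect a b j)
      ≈⟨ P▹-Λ u i (Cₙ.reflect a b j) ⟨
    (P ▹ u) (i , Cₙ.reflect a b j)          ∎

  module _ (D : SpectralDecomposition {{FV}} P) where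

    open SpectralDecomposition {{FV}} D
    open Decomposition D

    module _ (p : Fin count) where

      open Pr p

      Eₚ : Matrix Vertex Vertex
      Eₚ = E p

      θₚ : Carrier
      θₚ = θ p

      private
        -- For x = (i , j), the sum of the entries of E p from x to ℤ₄ × {j + z}.
        f : Vertex → ℤ → Carrier
        f x@(i , j) z = (Eₚ ▹ circle (j ⊕₂ z)) x

        f-even : ∀ x z → f x (ℤ.- z) ≈ f x z
        f-even x@(i , j) z = begin
          (Eₚ ▹ circle (j ⊕₂ (ℤ.- z))) x                       ≈⟨ ▹-cong (Eₚ) circle-reflect x ⟨
          (Eₚ ▹ (λ y → circle (j ⊕₂ z) (reflect₂ j j y))) x            ≈⟨ E▹-symmetry (reflect₂ j j) (λ (a , b) → ≡.cong (a ,_) (Cₙ.reflect-involutive j j b)) (P▹-reflect₂ j j) (circle (j ⊕₂ z)) x ⟩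
          (Eₚ ▹ circle (j ⊕₂ z)) (i , Cₙ.reflect j j j)        ≡⟨ ≡.cong (λ b → (Eₚ ▹ circle (j ⊕₂ z)) (i , b)) (Cₙ.reflect-right j j) ⟩
          (Eₚ ▹ circle (j ⊕₂ z)) x                             ∎
          where
          circle-reflect : (λ y → circle (j ⊕₂ z) (reflect₂ j j y)) ≈ⱽ circle (j ⊕₂ (ℤ.- z))
          circle-reflect (a , b) = 1ᴹ-⇔
            (λ eq → ≡.trans (≡.sym (Cₙ.reflect-involutive j j b)) (≡.trans (≡.cong (Cₙ.reflect j j) eq) (Cₙ.reflect-centre j z)))
            (λ eq → ≡.trans (≡.cong (Cₙ.reflect j j) (≡.trans eq (≡.sym (Cₙ.reflect-centre j z)))) (Cₙ.reflect-involutive j j (j ⊕₂ z)))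

        f-recurrence : ∀ x z → f x (z ℤ.+ 1ℤ) + f x (z ℤ.+ -1ℤ) ≈ 2# * (θₚ * f x z)
        f-recurrence x@(i , j) z = begin
          f x (z ℤ.+ 1ℤ) + f x (z ℤ.+ -1ℤ)        ≡⟨ ≡.cong₂ (λ b b′ → (Eₚ ▹ circle b) x + (Eₚ ▹ circle b′) x) (Cₙ.⊕-assoc j z 1ℤ) (Cₙ.⊕-assoc j z -1ℤ) ⟨
          s                                       ≈⟨ trans (sym (*-identityˡ s)) (*-congʳ (sym ½*2≈1)) ⟩
          ½ * 2# * s                              ≈⟨ solve 3 (λ h x y → h :* con (+ 2) :* (x :+ y) := con (+ 2) :* (h :* (x :+ y))) refl ½ _ _ ⟩
          2# * (½ * s)                            ≈⟨ *-congˡ (*-congˡ (▹-+ (Eₚ) (circle (b ⊕₂ 1ℤ)) (circle (b ⊕₂ -1ℤ)) x)) ⟨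
          2# * (½ * (Eₚ ▹ (λ y → circle (b ⊕₂ 1ℤ) y + circle (b ⊕₂ -1ℤ) y)) x) ≈⟨ *-congˡ (▹-scale (Eₚ) ½ (λ y → circle (b ⊕₂ 1ℤ) y + circle (b ⊕₂ -1ℤ) y) x) ⟨
          2# * (Eₚ ▹ (λ y → ½ * (circle (b ⊕₂ 1ℤ) y + circle (b ⊕₂ -1ℤ) y))) x ≈⟨ *-congˡ (▹-cong (Eₚ) (P▹circle b) x) ⟨
          2# * (Eₚ ▹ (P ▹ circle b)) x         ≈⟨ *-congˡ (E▹-P▹ (circle b) x) ⟩
          2# * (θₚ * f x z)                      ∎
          where
          b : Fin n
          b = j ⊕₂ z
          s : Carrier
          s = (Eₚ ▹ circle (b ⊕₂ 1ℤ)) x + (Eₚ ▹ circle (b ⊕₂ -1ℤ)) x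

        -- The projection h of circle j is constant on ℤ₄ × {j}, by reflection in
        -- the first coordinate, so its value there is a quarter of its squared
        -- norm h ∙ h = circle j ∙ h.
        0≤f[0] : ∀ x → 0# ≤ f x 0ℤ
        0≤f[0] x@(i , j) = ≤-respʳ (reflexive (≡.cong (λ b → (Eₚ ▹ circle b) x) (≡.sym (Cₙ.⊕-identity j))))
          (0≤halve (0≤halve (≤-respʳ norm (0≤∙ h))))
          where
          h : Vector Vertex
          h = Eₚ ▹ circle j
          0≤halve : ∀ {y} → 0# ≤ y + y → 0# ≤ y
          0≤halve {y} 0≤y+y y<0 = 0≤y+y (<-trans (<-respʳ-≈ (+-identityˡ y) (+-monoˡ-< y y<0)) y<0)
          h-constant : ∀ a → h (a , j) ≈ h (i , j)
          h-constant a = trans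
            (E▹-symmetry (reflect₁ i a) (λ (a′ , b) → ≡.cong (_, b) (C₄.reflect-involutive i a a′)) (P▹-reflect₁ i a) (circle j) (a , j))
            (reflexive (≡.cong (λ a′ → h (a′ , j)) (C₄.reflect-right i a)))
          norm : h ∙ h ≈ (h x + h x) + (h x + h x)
          norm = begin
            h ∙ h                                             ≈⟨ E▹-residual (circle j) h (E▹-eigen (circle j)) ⟨
            circle j ∙ h                                      ≈⟨ ⅀-product FV (λ y → circle j y * h y) ⟩
            ⅀ (λ a → ⅀ (λ b → [ b ≡ j ] * h (a , b)))            ≈⟨ ⅀-cong (λ a → ⅀-single _ j λ b b≢j → trans (*-congʳ (if-no (b ≟ j) b≢j)) (zeroˡ _)) ⟩
            ⅀ (λ a → [ j ≡ j ] * h (a , j))                      ≈⟨ ⅀-cong (λ a → trans (*-congʳ (if-yes (j ≟ j) ≡.refl)) (trans (*-identityˡ _) (h-constant a))) ⟩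
            ⅀ {A = Fin 4} (λ a → h x)                         ≈⟨ ⅀≈∑ {A = Fin 4} (λ a → h x) ⟩
            h x + (h x + (h x + (h x + 0#)))                  ≈⟨ solve 1 (λ y → y :+ (y :+ (y :+ (y :+ con 0ℤ))) := (y :+ y) :+ (y :+ y)) refl (h x) ⟩
            (h x + h x) + (h x + h x)                         ∎

        -- For x = (i , j), the sum of the entries of E p from x to ℤ₄ × {b}, with
        -- alternating signs that start with + at (i , b).
        γ : Vertex → Fin n → Carrier
        γ x@(i , _) b = alternating i * (Eₚ ▹ alternatingCircle b) x

        -- In the entry at (i ± 1 , b) the components of frequency 1 and 3 along ℤ₄
        -- cancel, because the reflection that fixes i exchanges i + 1 and i - 1;
        -- those of frequency 0 and 2 remain.
        4*E : ∀ x {ε} → ε ≡ 1ℤ ⊎ ε ≡ -1ℤ → ∀ b →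
          2# * (2# * Eₚ x (proj₁ x ⊕₁ ε , b)) ≈ (Eₚ ▹ circle b) x - γ x b
        4*E x@(i , j) {ε} hε b = trans (split i ε hε ≡.refl) (+-cong (sym circle≈) (-‿cong (sym γ≈)))
          where
          e : Fin 4 → Carrier
          e a = Eₚ x (a , b)
          γ′ : Fin 4 → Carrier
          γ′ i = alternating i * (1# * e 0F + (- 1#) * e 1F + 1# * e 2F + (- 1#) * e 3F)
          ⅀-circle : ∀ (φ : Fin 4 → Carrier) → (Eₚ ▹ (λ (a , b′) → φ a * [ b′ ≡ b ])) x ≈ φ 0F * e 0F + φ 1F * e 1F + φ 2F * e 2F + φ 3F * e 3F
          ⅀-circle φ = begin
            (Eₚ ▹ (λ (a , b′) → φ a * [ b′ ≡ b ])) x                        ≈⟨ ⅀-product FV (λ (a , b′) → Eₚ x (a , b′) * (φ a * [ b′ ≡ b ])) ⟩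
            ⅀ (λ a → ⅀ (λ b′ → Eₚ x (a , b′) * (φ a * [ b′ ≡ b ])))         ≈⟨ ⅀-cong (λ a → ⅀-single _ b λ b′ b′≢b → trans (*-congˡ (trans (*-congˡ (if-no (b′ ≟ b) b′≢b)) (zeroʳ _))) (zeroʳ _)) ⟩
            ⅀ (λ a → e a * (φ a * [ b ≡ b ]))                                ≈⟨ ⅀-cong (λ a → trans (*-congˡ (trans (*-congˡ (if-yes (b ≟ b) ≡.refl)) (*-identityʳ _))) (*-comm _ _)) ⟩
            ⅀ (λ a → φ a * e a)                                           ≈⟨ ⅀≈∑ (λ a → φ a * e a) ⟩
            φ 0F * e 0F + (φ 1F * e 1F + (φ 2F * e 2F + (φ 3F * e 3F + 0#)))
              ≈⟨ solve 4 (λ a b c d → a :+ (b :+ (c :+ (d :+ con 0ℤ))) := a :+ b :+ c :+ d) refl _ _ _ _ ⟩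
            φ 0F * e 0F + φ 1F * e 1F + φ 2F * e 2F + φ 3F * e 3F         ∎
          circle≈ : (Eₚ ▹ circle b) x ≈ e 0F + e 1F + e 2F + e 3F
          circle≈ = begin
            (Eₚ ▹ circle b) x                            ≈⟨ ▹-cong (Eₚ) (λ (a , b′) → *-identityˡ ([ b′ ≡ b ])) x ⟨
            (Eₚ ▹ (λ (a , b′) → 1# * [ b′ ≡ b ])) x         ≈⟨ ⅀-circle (λ _ → 1#) ⟩
            1# * e 0F + 1# * e 1F + 1# * e 2F + 1# * e 3F ≈⟨ +-cong (+-cong (+-cong (*-identityˡ _) (*-identityˡ _)) (*-identityˡ _)) (*-identityˡ _) ⟩
            e 0F + e 1F + e 2F + e 3F                     ∎
          γ≈ : γ x b ≈ γ′ i
          γ≈ = *-congˡ (⅀-circle alternating)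
          e-reflect : ∀ a → e (C₄.reflect i i a) ≈ e a
          e-reflect a = begin
            Eₚ x (π (a , b))                  ≈⟨ ▹-δ (Eₚ) (π (a , b)) x ⟨
            (Eₚ ▹ δ (π (a , b))) x            ≈⟨ ▹-cong (Eₚ) δ-reflect x ⟨
            (Eₚ ▹ (λ y → δ (a , b) (π y))) x          ≈⟨ E▹-symmetry π π-involutive (P▹-reflect₁ i i) (δ (a , b)) x ⟩
            (Eₚ ▹ δ (a , b)) (π x)            ≡⟨ ≡.cong (λ a′ → (Eₚ ▹ δ (a , b)) (a′ , j)) (C₄.reflect-right i i) ⟩
            (Eₚ ▹ δ (a , b)) x                ≈⟨ ▹-δ (Eₚ) (a , b) x ⟩
            Eₚ x (a , b)                      ∎
            where
            π : Vertex → Vertex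
            π = reflect₁ i i
            π-involutive : ∀ y → π (π y) ≡ y
            π-involutive (a′ , b′) = ≡.cong (_, b′) (C₄.reflect-involutive i i a′)
            δ-reflect : (λ y → δ (a , b) (π y)) ≈ⱽ δ (π (a , b))
            δ-reflect y with Finite._≟_ FV (π y) (a , b) | Finite._≟_ FV y (π (a , b))
            ... | yes _  | yes _  = refl
            ... | no _   | no _   = refl
            ... | yes eq | no ne  = contradiction (≡.trans (≡.sym (π-involutive y)) (≡.cong π eq)) ne
            ... | no ne  | yes eq = contradiction (≡.trans (≡.cong π eq) (π-involutive (a , b))) ne
          e-opposite : ∀ z → e (i ⊕₁ (ℤ.- z)) ≈ e (i ⊕₁ z)
          e-opposite z = trans (reflexive (≡.cong e (≡.sym (C₄.reflect-centre i z)))) (e-reflect (i ⊕₁ z))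
          -- The two neighbours of i are 1 and 3 if i is even, 0 and 2 if i is odd.
          odd⁺ : e 3F ≈ e 1F → 2# * (2# * e 1F) ≈ (e 0F + e 1F + e 2F + e 3F) - 1# * (1# * e 0F + (- 1#) * e 1F + 1# * e 2F + (- 1#) * e 3F)
          odd⁺ eq = begin
            2# * (2# * e 1F)             ≈⟨ solve 1 (λ x → con (+ 2) :* (con (+ 2) :* x) := con (+ 2) :* (x :+ x)) refl (e 1F) ⟩
            2# * (e 1F + e 1F)           ≈⟨ *-congˡ (+-congˡ eq) ⟨
            2# * (e 1F + e 3F)           ≈⟨ solve 4 (λ a b c d → con (+ 2) :* (b :+ d) := (a :+ b :+ c :+ d) :- con 1ℤ :* (con 1ℤ :* a :+ (:- con 1ℤ) :* b :+ con 1ℤ :* c :+ (:- con 1ℤ) :* d)) refl (e 0F) (e 1F) (e 2F) (e 3F) ⟩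
            _                            ∎
          even⁺ : e 2F ≈ e 0F → 2# * (2# * e 0F) ≈ (e 0F + e 1F + e 2F + e 3F) - (- 1#) * (1# * e 0F + (- 1#) * e 1F + 1# * e 2F + (- 1#) * e 3F)
          even⁺ eq = begin
            2# * (2# * e 0F)             ≈⟨ solve 1 (λ x → con (+ 2) :* (con (+ 2) :* x) := con (+ 2) :* (x :+ x)) refl (e 0F) ⟩
            2# * (e 0F + e 0F)           ≈⟨ *-congˡ (+-congˡ eq) ⟨
            2# * (e 0F + e 2F)           ≈⟨ solve 4 (λ a b c d → con (+ 2) :* (a :+ c) := (a :+ b :+ c :+ d) :- (:- con 1ℤ) :* (con 1ℤ :* a :+ (:- con 1ℤ) :* b :+ con 1ℤ :* c :+ (:- con 1ℤ) :* d)) refl (e 0F) (e 1F) (e 2F) (e 3F) ⟩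
            _                            ∎
          split : ∀ i′ ε′ → ε′ ≡ 1ℤ ⊎ ε′ ≡ -1ℤ → i ≡ i′ →
            2# * (2# * e (i′ ⊕₁ ε′)) ≈ (e 0F + e 1F + e 2F + e 3F) - γ′ i′
          split 0F _ (inj₁ ≡.refl) ≡.refl = odd⁺ (e-opposite 1ℤ)
          split 0F _ (inj₂ ≡.refl) ≡.refl = trans (*-congˡ (*-congˡ (e-opposite 1ℤ))) (odd⁺ (e-opposite 1ℤ))
          split 1F _ (inj₁ ≡.refl) ≡.refl = trans (*-congˡ (*-congˡ (e-opposite -1ℤ))) (even⁺ (e-opposite -1ℤ))
          split 1F _ (inj₂ ≡.refl) ≡.refl = even⁺ (e-opposite -1ℤ)
          split 2F _ (inj₁ ≡.refl) ≡.refl = trans (*-congˡ (*-congˡ (e-opposite -1ℤ))) (odd⁺ (e-opposite -1ℤ))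
          split 2F _ (inj₂ ≡.refl) ≡.refl = odd⁺ (e-opposite -1ℤ)
          split 3F _ (inj₁ ≡.refl) ≡.refl = even⁺ (e-opposite 1ℤ)
          split 3F _ (inj₂ ≡.refl) ≡.refl = trans (*-congˡ (*-congˡ (e-opposite 1ℤ))) (even⁺ (e-opposite 1ℤ))

        -1-eigenvalue : Fin n → IsEigenvalue {{FV}} P (- 1#)
        -1-eigenvalue b = alternatingCircle b , Eigen⇒Eigenspace (alternatingCircle-eigen b) , (0F , b) ,
          >⇒# (<-respʳ-≈ (sym (trans (*-identityˡ _) (if-yes (b ≟ b) ≡.refl))) 0<1)

        -- E p fixes or annihilates the (-1)-eigenvector alternatingCircle b.  Which
        -- of the two holds is decided by comparing p with the index of the
        -- eigenvalue -1, equality of real numbers not being decidable.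
        γ-cases : ∀ x b → γ x b ≈ 0# ⊎ (θₚ ≈ - 1# × γ x b ≈ [ proj₂ x ≡ b ])
        γ-cases x@(i , j) b = by-cases (θ-exhaustive (- 1#) (-1-eigenvalue b))
          where
          by-cases : (∃[ q ] - 1# ≈ θ q) → γ x b ≈ 0# ⊎ (θₚ ≈ - 1# × γ x b ≈ [ j ≡ b ])
          by-cases (q , -1≈θq) = compare (q Finₚ.≟ p)
            where
            eigen : Eigen (θ q) (alternatingCircle b)
            eigen y = trans (alternatingCircle-eigen b y) (*-congʳ -1≈θq)
            compare : Dec (q ≡ p) → γ x b ≈ 0# ⊎ (θₚ ≈ - 1# × γ x b ≈ [ j ≡ b ])
            compare (yes ≡.refl) = inj₂ (sym -1≈θq , trans (*-congˡ (E▹-fixes eigen x)) (alternating² i [ j ≡ b ]))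
            compare (no q≢p)     = inj₁ (trans (*-congˡ (E▹-annihilates (θ-distinct q≢p) eigen x)) (zeroʳ _))

      -- The entry from (i , j) to (i ± 1 , j ± t).  By the last hypothesis, the
      -- second coordinate changes or T t (-1) = -1.
      module _ (t : ℕ) (n∣4t : n ∣ 4 ℕ.* t) (i : Fin 4) (j : Fin n)
        {ε : ℤ} (ε≡±1 : ε ≡ 1ℤ ⊎ ε ≡ -1ℤ)
        {b : Fin n} (b≡j±t : b ≡ j ⊕₂ + t ⊎ b ≡ j ⊕₂ (ℤ.- + t))
        (moves⊎odd : j ≢ b ⊎ T t (- 1#) ≈ - 1#)
        where

        private
          x : Vertex
          x = i , j

          open EvenSequence.Cosine ℝ θₚ (f x) (f-even x) (f-recurrence x)

          τ φ g e : Carrier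
          τ = T t θₚ
          φ = f x (+ t)
          g = γ x b
          e = Eₚ x (i ⊕₁ ε , b)

          period : f x (+ t ℤ.- + (4 ℕ.* t)) ≈ φ
          period = reflexive (≡.cong (λ b → (Eₚ ▹ circle b) x)
            (≡.trans (≡.sym (Cₙ.⊕-assoc j (+ t) (ℤ.- + (4 ℕ.* t)))) (Cₙ.⊕-multiple (j ⊕₂ + t) _ (multiple n∣4t))))
            where
            multiple : n ∣ 4 ℕ.* t → ℤ.- + (4 ℕ.* t) Cₙ.≈ₙ 0ℤ
            multiple (divides q eq) = Cₙ.multiple (ℤ.- + q) (≡.trans (≡.cong (λ k → ℤ.- + k) eq)
              (≡.trans (≡.cong ℤ.-_ (ℤₚ.pos-* q n)) (≡.trans (ℤₚ.neg-distribˡ-* (+ q) (+ n)) (≡.sym (ℤₚ.+-identityˡ _)))))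

          τ*τ*φ : τ * (τ * φ) ≈ φ
          τ*τ*φ = T*T*f[t] t period

          0≤τ*φ : 0# ≤ τ * φ
          0≤τ*φ = ≤-respʳ (trans (*-assoc τ τ (f x 0ℤ)) (*-congˡ (T*f[0] t))) (0≤* (0≤² τ) (0≤f[0] x))

          τ*0 : ∀ {y} → y ≈ 0# → τ * y ≈ - y
          τ*0 {y} y≈0 = begin
            τ * y       ≈⟨ *-congˡ y≈0 ⟩
            τ * 0#      ≈⟨ solve 1 (λ x → x :* con 0ℤ := :- con 0ℤ) refl τ ⟩
            - 0#        ≈⟨ -‿cong y≈0 ⟨
            - y         ∎

          0≤g∧τ*g : 0# ≤ g × τ * g ≈ - g
          0≤g∧τ*g = by-cases (γ-cases x b)
            where
            by-cases : g ≈ 0# ⊎ (θₚ ≈ - 1# × g ≈ [ j ≡ b ]) → 0# ≤ g × τ * g ≈ - g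
            by-cases (inj₁ g≈0) = ≈⇒≤ (sym g≈0) , τ*0 g≈0
            by-cases (inj₂ (θ≈-1 , g≈)) = ≤-respʳ (sym g≈) (0≤1ᴹ j b) , at-[-1] moves⊎odd
              where
              at-[-1] : j ≢ b ⊎ T t (- 1#) ≈ - 1# → τ * g ≈ - g
              at-[-1] (inj₁ j≢b) = τ*0 (trans g≈ (if-no (j ≟ b) j≢b))
              at-[-1] (inj₂ odd) = trans (*-congʳ (trans (T-cong t θ≈-1) odd))
                (solve 1 (λ x → (:- con 1ℤ) :* x := :- x) refl g)

          4*e : 2# * (2# * e) ≈ φ - g
          4*e = trans (4*E x ε≡±1 b) (+-congʳ (circle-b b≡j±t))
            where
            circle-b : b ≡ j ⊕₂ + t ⊎ b ≡ j ⊕₂ (ℤ.- + t) → (Eₚ ▹ circle b) x ≈ φ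
            circle-b (inj₁ ≡.refl) = refl
            circle-b (inj₂ ≡.refl) = f-even x (+ t)

          cancel-4 : ∀ {y z} → 2# * (2# * y) ≈ 2# * (2# * z) → y ≈ z
          cancel-4 {y} {z} eq = double-injective (double-injective (trans (quadruple y) (trans eq (sym (quadruple z)))))
            where
            quadruple : ∀ y → (y + y) + (y + y) ≈ 2# * (2# * y)
            quadruple y = solve 1 (λ y → (y :+ y) :+ (y :+ y) := con (+ 2) :* (con (+ 2) :* y)) refl y

          4τ*e : 2# * (2# * (τ * e)) ≈ τ * φ + g
          4τ*e = begin
            2# * (2# * (τ * e))    ≈⟨ solve 2 (λ s e → con (+ 2) :* (con (+ 2) :* (s :* e)) := s :* (con (+ 2) :* (con (+ 2) :* e))) refl τ e ⟩
            τ * (2# * (2# * e))    ≈⟨ *-congˡ 4*e ⟩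
            τ * (φ - g)            ≈⟨ solve 3 (λ s x y → s :* (x :- y) := s :* x :- s :* y) refl τ φ g ⟩
            τ * φ - τ * g          ≈⟨ +-congˡ (-‿cong (proj₂ 0≤g∧τ*g)) ⟩
            τ * φ - (- g)          ≈⟨ solve 2 (λ x y → x :- (:- y) := x :+ y) refl (τ * φ) g ⟩
            τ * φ + g              ∎

          τ*τ*e : τ * (τ * e) ≈ e
          τ*τ*e = cancel-4 (begin
            2# * (2# * (τ * (τ * e)))   ≈⟨ solve 2 (λ s e → con (+ 2) :* (con (+ 2) :* (s :* e)) := s :* (con (+ 2) :* (con (+ 2) :* e))) refl τ (τ * e) ⟩
            τ * (2# * (2# * (τ * e)))   ≈⟨ *-congˡ 4τ*e ⟩
            τ * (τ * φ + g)             ≈⟨ distribˡ τ (τ * φ) g ⟩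
            τ * (τ * φ) + τ * g         ≈⟨ +-cong τ*τ*φ (proj₂ 0≤g∧τ*g) ⟩
            φ - g                       ≈⟨ 4*e ⟨
            2# * (2# * e)               ∎)

        0≤T*E : 0# ≤ T t θₚ * Eₚ (i , j) (i ⊕₁ ε , b)
        0≤T*E τe<0 = ≤-respʳ (sym 4τ*e) (0≤+ 0≤τ*φ (proj₁ 0≤g∧τ*g))
          (<-respˡ-≈ (solve 1 (λ y → (y :+ y) :+ (y :+ y) := con (+ 2) :* (con (+ 2) :* y)) refl (τ * e))
            (negative+ (negative+ τe<0)))
          where
          negative+ : ∀ {y} → y < 0# → y + y < 0#
          negative+ {y} y<0 = <-trans (<-respʳ-≈ (+-identityˡ y) (+-monoˡ-< y y<0)) y<0

        ∣E∣≈T*E : ∣ Eₚ (i , j) (i ⊕₁ ε , b) ∣ ≈ T t θₚ * Eₚ (i , j) (i ⊕₁ ε , b)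
        ∣E∣≈T*E = ∣∣-unique 0≤T*E (begin
          (τ * e) * (τ * e)     ≈⟨ solve 2 (λ s e → (s :* e) :* (s :* e) := e :* (s :* (s :* e))) refl τ e ⟩
          e * (τ * (τ * e))     ≈⟨ *-congˡ τ*τ*e ⟩
          e * e                 ∎)

        E#0 : 0# < (Eₚ ▹ circle (j ⊕₂ (+ t ℤ.+ + t))) (i , j) + (Eₚ ▹ circle (j ⊕₂ 0ℤ)) (i , j) →
          Eₚ (i , j) (i ⊕₁ ε , b) # 0#
        E#0 0<f = x*y#0⇒y#0 {2# * (2# * (2# * τ))} (>⇒# (<-respʳ-≈ eq (0≤+0< (0≤+ (proj₁ 0≤g∧τ*g) (proj₁ 0≤g∧τ*g)) 0<f)))
          where
          eq : (g + g) + (f x (+ t ℤ.+ + t) + f x 0ℤ) ≈ 2# * (2# * (2# * τ)) * e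
          eq = begin
            (g + g) + (f x (+ t ℤ.+ + t) + f x 0ℤ)   ≈⟨ +-congˡ (2T*f[t] t) ⟨
            (g + g) + 2# * (τ * φ)                   ≈⟨ solve 2 (λ g y → (g :+ g) :+ con (+ 2) :* y := con (+ 2) :* (y :+ g)) refl g (τ * φ) ⟩
            2# * (τ * φ + g)                         ≈⟨ *-congˡ 4τ*e ⟨
            2# * (2# * (2# * (τ * e)))               ≈⟨ solve 2 (λ s e → con (+ 2) :* (con (+ 2) :* (con (+ 2) :* (s :* e))) := con (+ 2) :* (con (+ 2) :* (con (+ 2) :* s)) :* e) refl τ e ⟩
            2# * (2# * (2# * τ)) * e                 ∎

    -- The equality and the nonvanishing required by peak state transfer, for a
    -- number β with the expansion of an entry of T t (P).
    peak : ∀ t → n ∣ 4 ℕ.* t → ∀ i j {ε b} → ε ≡ 1ℤ ⊎ ε ≡ -1ℤ → b ≡ j ⊕₂ + t ⊎ b ≡ j ⊕₂ (ℤ.- + t) →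
      j ≢ b ⊎ T t (- 1#) ≈ - 1# → ∀ β → β ≈ ⅀ (λ p → T t (θ p) * E p (i , j) (i ⊕₁ ε , b)) →
      (∣ β ∣ ≈ ∑ (λ p → ∣ E p (i , j) (i ⊕₁ ε , b) ∣)) × (∃[ p ] (E p (i , j) (i ⊕₁ ε , b) # 0#))
    peak t n∣4t i j {ε} {b} hε hb ho β β≈ = absolute , nonzero (0<⅀⇒∃0< h 0<⅀h)
      where
      open FiniteSums ℝ using (0<⅀⇒∃0<; ⅀-+; ⅀-nonneg)
      x : Vertex
      x = i , j
      absolute : ∣ β ∣ ≈ ∑ (λ p → ∣ E p x (i ⊕₁ ε , b) ∣)
      absolute = begin
        ∣ β ∣                                              ≈⟨ ∣∣-unique (⅀-nonneg λ p → 0≤T*E p t n∣4t i j hε hb ho) (*-cong (sym β≈) (sym β≈)) ⟩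
        ⅀ (λ p → T t (θ p) * E p x (i ⊕₁ ε , b))           ≈⟨ ⅀-cong (λ p → ∣E∣≈T*E p t n∣4t i j hε hb ho) ⟨
        ⅀ (λ p → ∣ E p x (i ⊕₁ ε , b) ∣)                   ≈⟨ ⅀≈∑ (λ p → ∣ E p x (i ⊕₁ ε , b) ∣) ⟩
        ∑ (λ p → ∣ E p x (i ⊕₁ ε , b) ∣)                   ∎
      -- The value f (2 t) + f 0 for E p; by completeness, these values add up to
      -- [ j ≡ j + 2 t ] + [ j ≡ j ] > 0.
      h : Fin count → Carrier
      h p = (E p ▹ circle (j ⊕₂ (+ t ℤ.+ + t))) x + (E p ▹ circle (j ⊕₂ 0ℤ)) x
      0<⅀h : 0# < ⅀ h
      0<⅀h = <-respʳ-≈ (sym (trans (⅀-+ (λ p → (E p ▹ circle (j ⊕₂ (+ t ℤ.+ + t))) x) (λ p → (E p ▹ circle (j ⊕₂ 0ℤ)) x))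
                 (+-cong (E▹-complete (circle (j ⊕₂ (+ t ℤ.+ + t))) x) (E▹-complete (circle (j ⊕₂ 0ℤ)) x))))
        (0≤+0< (0≤1ᴹ j (j ⊕₂ (+ t ℤ.+ + t))) (<-respʳ-≈ (sym (if-yes (j ≟ (j ⊕₂ 0ℤ)) (≡.sym (Cₙ.⊕-identity j)))) 0<1))
      nonzero : (∃[ p ] 0# < h p) → ∃[ p ] (E p x (i ⊕₁ ε , b) # 0#)
      nonzero (p , 0<h) = p , E#0 p t n∣4t i j hε hb ho 0<h

-- Peak state transfer

open import Data.Integer.Base using (-_)
open import Data.Nat.Base using (_*_)

even⊎odd : ∀ n → 2 ∣ n ⊎ (∃[ k ] n ≡ suc (k ℕ.+ k))
even⊎odd zero = inj₁ (divides 0 ≡.refl)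
even⊎odd (suc n) with even⊎odd n
... | inj₁ (divides k ≡.refl) = inj₂ (k , ≡.cong suc (≡.trans (ℕₚ.*-comm k 2) (≡.cong (k ℕ.+_) (ℕₚ.+-identityʳ k))))
... | inj₂ (k , ≡.refl) = inj₁ (divides (suc k) (≡.cong (λ l → suc (suc l)) (≡.sym (≡.trans (ℕₚ.*-comm k 2) (≡.cong (k ℕ.+_) (ℕₚ.+-identityʳ k))))))

module PeakTransfer {c ℓ₁ ℓ₂} (ℝ : RealNumbers c ℓ₁ ℓ₂) (n : ℕ) .{{n≢0 : NonZero n}}
  (D : LinearAlgebra.SpectralDecomposition ℝ (VertexFaceWalk.B ℝ 4 n 1)) where

  open VertexFaceWalk ℝ 4 n
  private
    module R = RealNumbers ℝ
    module G = GridWalk ℝ 4 n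
    module W = TwoReflections ℝ N M
    module Cₙ = Cyclic n {{n≢0}}
    module S = TorusSpectrum ℝ n ×-finite (B 1) (W.B1-selfAdjoint G.N-isometry) G.B1▹-Λ
  open Chebyshev ℝ using (T; T[-1]-odd)

  ⊕-±1-moves : ∀ (i : Fin 4) {ε} → ε ≡ 1ℤ ⊎ ε ≡ -1ℤ → i ≢ i ⊕ ε
  ⊕-±1-moves 0F (inj₁ ≡.refl) ()
  ⊕-±1-moves 0F (inj₂ ≡.refl) ()
  ⊕-±1-moves 1F (inj₁ ≡.refl) ()
  ⊕-±1-moves 1F (inj₂ ≡.refl) ()
  ⊕-±1-moves 2F (inj₁ ≡.refl) ()
  ⊕-±1-moves 2F (inj₂ ≡.refl) ()
  ⊕-±1-moves 3F (inj₁ ≡.refl) ()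
  ⊕-±1-moves 3F (inj₂ ≡.refl) ()

  -- The common form of the three families.
  transfer : ∀ t → 0 ℕ.< t → n ∣ 4 * t → ∀ i j {ε b} → ε ≡ 1ℤ ⊎ ε ≡ -1ℤ → b ≡ j ⊕ (+ t) ⊎ b ≡ j ⊕ (- (+ t)) →
    j ≢ b ⊎ T t (R.- R.1#) R.≈ R.- R.1# → PeakStateTransfer D (i , j) (i ⊕ ε , b) t
  transfer t 0<t n∣4t i j {ε} {b} hε hb ho =
      (λ eq → ⊕-±1-moves i hε (≡.cong proj₁ eq)) , 0<t , proj₁ result , proj₂ result
    where
    result = S.peak D t n∣4t i j hε hb ho (B t (i , j) (i ⊕ ε , b)) (W.B-expand G.N-isometry G.M-isometry D t (i , j) (i ⊕ ε , b))

  -- The time n, with j = j + n as the second coordinate of the target.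
  odd-transfer : ∀ k → n ≡ suc (k ℕ.+ k) → ∀ i j {ε} → ε ≡ 1ℤ ⊎ ε ≡ -1ℤ →
    PeakStateTransfer D (i , j) (i ⊕ ε , j ⊕ 0ℤ) n
  odd-transfer k n≡ i j hε = transfer n (ℕ.>-nonZero⁻¹ n) (divides 4 ≡.refl) i j hε
    (inj₁ (≡.trans (Cₙ.⊕-identity j) (≡.sym (Cₙ.⊕-multiple j (+ n)
      (Cₙ.multiple 1ℤ (≡.sym (≡.trans (ℤₚ.+-identityˡ _) (ℤₚ.*-identityˡ (+ n)))))))))
    (inj₂ (≡.subst (λ l → T l (R.- R.1#) R.≈ R.- R.1#) (≡.sym n≡) (T[-1]-odd k)))

  -- The times n / 2 and n / 4.
  fraction-transfer : ∀ c → 1 ℕ.< c → c ∣ 4 → ∀ m → n ≡ c * m → ∀ i j {ε z} → ε ≡ 1ℤ ⊎ ε ≡ -1ℤ → z ≡ + m ⊎ z ≡ - (+ m) →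
    PeakStateTransfer D (i , j) (i ⊕ ε , j ⊕ z) m
  fraction-transfer c 1<c (divides q 4≡qc) m n≡cm i j {ε} {z} hε hz = transfer m 0<m n∣4m i j hε (offset hz)
      (inj₁ (λ j≡ → Cₙ.⊕-moves j z (λ z≡0 → ℕₚ.<-irrefl (≡.sym (≡.trans (≡.sym (∣z∣≡m hz)) (≡.cong ℤ.∣_∣ z≡0))) 0<m)
        (≡.subst (ℕ._< n) (≡.sym (∣z∣≡m hz)) m<n) (≡.sym j≡)))
    where
    0<m : 0 ℕ.< m
    0<m = ℕₚ.n≢0⇒n>0 λ { ≡.refl → ℕₚ.<-irrefl (≡.sym (≡.trans n≡cm (ℕₚ.*-zeroʳ c))) (ℕ.>-nonZero⁻¹ n) }
    m<n : m ℕ.< n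
    m<n = ≡.subst (m ℕ.<_) (≡.sym n≡cm) (≡.subst (ℕ._< c * m) (ℕₚ.*-identityˡ m) (ℕₚ.*-monoˡ-< m {{ℕ.>-nonZero 0<m}} 1<c))
    n∣4m : n ∣ 4 * m
    n∣4m = divides q (≡.trans (≡.cong (_* m) 4≡qc) (≡.trans (ℕₚ.*-assoc q c m) (≡.cong (q *_) (≡.sym n≡cm))))
    ∣z∣≡m : z ≡ + m ⊎ z ≡ - (+ m) → ℤ.∣ z ∣ ≡ m
    ∣z∣≡m (inj₁ ≡.refl) = ≡.refl
    ∣z∣≡m (inj₂ ≡.refl) = ℤₚ.∣-i∣≡∣i∣ (+ m)
    offset : z ≡ + m ⊎ z ≡ - (+ m) → j ⊕ z ≡ j ⊕ (+ m) ⊎ j ⊕ z ≡ j ⊕ (- (+ m))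
    offset (inj₁ ≡.refl) = inj₁ ≡.refl
    offset (inj₂ ≡.refl) = inj₂ ≡.refl

theorem6p7 :
  ∀ {c ℓ₁ ℓ₂} (ℝ : RealNumbers c ℓ₁ ℓ₂) (n : ℕ) .{{_ : NonZero n}} →
  let open LinearAlgebra ℝ
      open VertexFaceWalk ℝ 4 n
  in
  (D : SpectralDecomposition (B 1)) →
    (∃[ x ] ∃[ y ] ∃[ t ] PeakStateTransfer D x y t)
  × (∀ (i : Fin 4) (j : Fin n) →
      (¬ 2 ∣ n →
          PeakStateTransfer D (i , j) ((i , j) ⊞ (1ℤ , 0ℤ)) n
        × PeakStateTransfer D (i , j) ((i , j) ⊞ (-1ℤ , 0ℤ)) n)
    × (∀ (m : ℕ) → n ≡ 2 * m →
          PeakStateTransfer D (i , j) ((i , j) ⊞ (1ℤ , + m)) m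
        × PeakStateTransfer D (i , j) ((i , j) ⊞ (-1ℤ , + m)) m)
    × (∀ (k : ℕ) → n ≡ 4 * k →
          PeakStateTransfer D (i , j) ((i , j) ⊞ (1ℤ , + k)) k
        × PeakStateTransfer D (i , j) ((i , j) ⊞ (1ℤ , - (+ k))) k
        × PeakStateTransfer D (i , j) ((i , j) ⊞ (-1ℤ , + k)) k
        × PeakStateTransfer D (i , j) ((i , j) ⊞ (-1ℤ , - (+ k))) k))
theorem6p7 ℝ n D = somewhere (even⊎odd n) , λ i j →
    (λ 2∤n → odd i j (even⊎odd n) 2∤n 1ℤ (inj₁ ≡.refl) , odd i j (even⊎odd n) 2∤n -1ℤ (inj₂ ≡.refl))
  , (λ m n≡2m → half m n≡2m i j (inj₁ ≡.refl) (inj₁ ≡.refl) , half m n≡2m i j (inj₂ ≡.refl) (inj₁ ≡.refl))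
  , (λ k n≡4k → quarter k n≡4k i j (inj₁ ≡.refl) (inj₁ ≡.refl) , quarter k n≡4k i j (inj₁ ≡.refl) (inj₂ ≡.refl)
              , quarter k n≡4k i j (inj₂ ≡.refl) (inj₁ ≡.refl) , quarter k n≡4k i j (inj₂ ≡.refl) (inj₂ ≡.refl))
  where
  open LinearAlgebra ℝ
  open VertexFaceWalk ℝ 4 n
  open PeakTransfer ℝ n D
  half : ∀ m → n ≡ 2 * m → ∀ i j {ε z} → ε ≡ 1ℤ ⊎ ε ≡ -1ℤ → z ≡ + m ⊎ z ≡ - (+ m) → PeakStateTransfer D (i , j) (i ⊕ ε , j ⊕ z) m
  half = fraction-transfer 2 (ℕ.s≤s (ℕ.s≤s ℕ.z≤n)) (divides 2 ≡.refl)
  quarter : ∀ m → n ≡ 4 * m → ∀ i j {ε z} → ε ≡ 1ℤ ⊎ ε ≡ -1ℤ → z ≡ + m ⊎ z ≡ - (+ m) → PeakStateTransfer D (i , j) (i ⊕ ε , j ⊕ z) m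
  quarter = fraction-transfer 4 (ℕ.s≤s (ℕ.s≤s ℕ.z≤n)) (divides 1 ≡.refl)
  odd : ∀ i j → 2 ∣ n ⊎ (∃[ k ] n ≡ suc (k ℕ.+ k)) → ¬ 2 ∣ n → ∀ ε → ε ≡ 1ℤ ⊎ ε ≡ -1ℤ → PeakStateTransfer D (i , j) (i ⊕ ε , j ⊕ 0ℤ) n
  odd i j (inj₁ 2∣n) 2∤n ε hε = contradiction 2∣n 2∤n
  odd i j (inj₂ (k , n≡)) _ ε hε = odd-transfer k n≡ i j hε
  j₀ : Fin n
  j₀ = fromℕ< (ℕ.>-nonZero⁻¹ n)
  somewhere : 2 ∣ n ⊎ (∃[ k ] n ≡ suc (k ℕ.+ k)) → ∃[ x ] ∃[ y ] ∃[ t ] PeakStateTransfer D x y t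
  somewhere (inj₁ (divides k n≡)) = _ , _ , k , half k (≡.trans n≡ (ℕₚ.*-comm k 2)) 0F j₀ (inj₁ ≡.refl) (inj₁ ≡.refl)
  somewhere (inj₂ (k , n≡)) = _ , _ , n , odd-transfer k n≡ 0F j₀ (inj₁ ≡.refl)
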